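{- The integrality gap of the LP-relaxation of the integer program (IP) described in the context, even when restricted to directed acyclic graphs, is $\Omega(n^{1/3})$, where $n$ is the number of nodes of the input DAG. That is, there are a constant $c>0$ and a family of DAGs with specified roots, with unboundedly many nodes, such that for each member of the family with $n$ nodes the ratio of the optimum value of the LP-relaxation to the optimum value of (IP) is at least $c\,n^{1/3}$.
   Context: Let $G=(V,E)$ be a directed graph with root $r\in V$. For a vertex $u$, let $\delta^{in}(u)$ and $\delta^{out}(u)$ be the sets of arcs entering and leaving $u$, respectively; for $S\subseteq V$, let $\delta^{out}(S)$ be the set of arcs with tail in $S$ and head outside $S$. The integer program (IP) has variables $Y_u$ ($u\in V$) and $X_e$ ($e\in E$): maximize $\sum_{v\in V}Y_v$ subject to $\sum_{e\in\delta^{in}(u)}X_e\le 2Y_u$ for all $u\in V$; $\sum_{e\in\delta^{out}(u)}X_e=Y_u$ for all $u\in V\setminus\{r\}$; $\sum_{e\in\delta^{out}(S)}X_e\ge Y_u$ for all $S\subseteq V\setminus\{r\}$ and all $u\in S$; $0\le Y_u\le 1$ for all $u\in V$; $0\le X_e\le 1$ for all $e\in E$; $Y\in\mathbb{Z}^{V}$, $X\in\mathbb{Z}^{E}$. The LP-relaxation is obtained by dropping the integrality constraints in the last line. (The integral solutions encode $r$-rooted binary trees with arcs directed towards the root: each vertex has in-degree at most $2$ and each non-root chosen vertex has out-degree $1$.) -}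

module Defs where

open import Algebra.Properties.CommutativeMonoid.Sum using (sum)
open import Data.Bool using (Bool; _∧_; not; if_then_else_)
open import Data.Fin using (Fin; _≟_)
open import Data.Fin.Subset using (Subset; _∈_; _∉_)
open import Data.Fin.Subset.Properties using (_∈?_)
open import Data.Integer using (ℤ; +_)
open import Data.Nat using (ℕ)
open import Data.Product using (_×_; ∃-syntax; Σ-syntax)
open import Data.Rational using (ℚ; 0ℚ; 1ℚ; _*_; _/_; _≤_; _<_)
open import Data.Rational.Properties using (+-0-commutativeMonoid)
open import Level using (0ℓ)
open import Relation.Binary using (Rel; Decidable)
open import Relation.Binary.Construct.Closure.Transitive using (TransClosure)
open import Relation.Binary.PropositionalEquality using (_≡_; _≢_)
open import Relation.Nullary using (¬_; does)

record Digraph (n : ℕ) : Set₁ where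
  field
    Arc  : Rel (Fin n) 0ℓ
    arc? : Decidable Arc

Acyclic : ∀ {n} → Digraph n → Set
Acyclic G = ∀ v → ¬ TransClosure Arc v v
  where open Digraph G

ArcSet : ℕ → Set
ArcSet n = (t h : Fin n) → Bool

module _ {n : ℕ} (G : Digraph n) where
  open Digraph G

  δin : Fin n → ArcSet n
  δin u t h = does (arc? t h) ∧ does (h ≟ u)

  δout : Fin n → ArcSet n
  δout u t h = does (arc? t h) ∧ does (t ≟ u)

  δoutˢ : Subset n → ArcSet n
  δoutˢ S t h = does (arc? t h) ∧ (does (t ∈? S) ∧ not (does (h ∈? S)))

∑ : ∀ {n} → (Fin n → ℚ) → ℚ
∑ = sum +-0-commutativeMonoid

∑ᴬ : ∀ {n} → ArcSet n → (Fin n → Fin n → ℚ) → ℚ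
∑ᴬ F X = ∑ λ t → ∑ λ h → if F t h then X t h else 0ℚ

-- The variable of the arc from t to h is X t h.  The entries of X at pairs that
-- are not arcs are not variables: no constraint and no objective mentions them.

record Assignment (n : ℕ) : Set where
  field
    Y : Fin n → ℚ
    X : Fin n → Fin n → ℚ

objective : ∀ {n} → Assignment n → ℚ
objective a = ∑ (Assignment.Y a)

record LPFeasible {n} (G : Digraph n) (r : Fin n) (a : Assignment n) : Set where
  open Digraph G
  open Assignment a
  field
    in-degree    : ∀ u → ∑ᴬ (δin G u) X ≤ (+ 2 / 1) * Y u
    out-degree   : ∀ u → u ≢ r → ∑ᴬ (δout G u) X ≡ Y u
    connectivity : ∀ S → r ∉ S → ∀ u → u ∈ S → Y u ≤ ∑ᴬ (δoutˢ G S) X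
    Y-bounds     : ∀ u → 0ℚ ≤ Y u × Y u ≤ 1ℚ
    X-bounds     : ∀ {t h} → Arc t h → 0ℚ ≤ X t h × X t h ≤ 1ℚ

IsInteger : ℚ → Set
IsInteger q = ∃[ z ] q ≡ z / 1

record IPFeasible {n} (G : Digraph n) (r : Fin n) (a : Assignment n) : Set where
  open Digraph G
  open Assignment a
  field
    lpFeasible : LPFeasible G r a
    Y-integral : ∀ u → IsInteger (Y u)
    X-integral : ∀ {t h} → Arc t h → IsInteger (X t h)

-- v is the maximum, attained, of the objective over the feasible assignments.
-- Since the program has rational data, its optimum over ℝ is attained at a
-- rational point, so the optimum over ℚ is the same number.

IsOptimum : ∀ {n} → (Assignment n → Set) → ℚ → Set
IsOptimum Feasible v =
  (∃[ a ] Feasible a × objective a ≡ v) × (∀ a → Feasible a → objective a ≤ v)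

-- ρ is the ratio of the LP optimum to the IP optimum.

IsGap : ∀ {n} → Digraph n → Fin n → ℚ → Set
IsGap G r ρ =
  Σ[ lp ∈ ℚ ] Σ[ ip ∈ ℚ ]
    IsOptimum (LPFeasible G r) lp × IsOptimum (IPFeasible G r) ip ×
    0ℚ < ip × ρ * ip ≡ lp

-- c · n^(1/3) ≤ ρ, cubed on both sides (cubing is strictly increasing on ℝ).

infix 4 _·∛_≤_

_·∛_≤_ : ℚ → ℕ → ℚ → Set
c ·∛ n ≤ ρ = (c * c * c) * (+ n / 1) ≤ ρ * ρ * ρ

{-# OPTIONS --safe #-}
module Submission where

-- Take m ≥ 2, k = 2m, W = m² and K = ℓ = m.  The root has two in-neighbours: the hub and the end ("origin") of a
-- spine path.  Each of the k groups has one spine vertex, a trunk, W links, K items and a tail of ℓ vertices behind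
-- every item.  A trunk is a path towards the hub; every link points to its own trunk vertex and to the place of the
-- spine where the group is attached; every item points to all links of its group.
--
-- Fractionally, each trunk carries 1/m and each link enters the spine with weight 1/m².  The W links of a group
-- together send a full unit along the spine, so all items can be chosen fully, while the weight that a link borrows
-- from its trunk lets it take a share of all K items.  Hence the LP optimum is of order m³, like the number of vertices.
-- Integrally, the hub admits only two trunks.  In a group whose trunk is not chosen, at most two links enter the spine
-- and they take at most four items.  Hence the integral optimum is of order m².

open import Defs
import Algebra.Properties.CommutativeMonoid.Sum as CMSum
import Algebra.Properties.Semiring.Sum as SRSum
open import Algebra.Bundles using (CommutativeRing)
open import Data.Bool using (Bool; true; false; if_then_else_; _∧_; not)
open import Data.Empty using (⊥-elim)
open import Data.Fin using (Fin; zero; suc; inject₁; toℕ; splitAt; remQuot; punchIn; punchOut)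
import Data.Fin as Fin
import Data.Fin.Properties as Fin
open import Data.Fin.Induction using (<-weakInduction)
open import Data.Fin.Subset using (Subset; _∈_; _∉_; ⁅_⁆; _∪_)
open import Data.Fin.Subset.Properties using (_∈?_; anySubset?; x∈⁅x⁆; x∈⁅y⁆⇒x≡y; x∈p∪q⁻; x∈p∪q⁺)
import Data.Integer as ℤ
import Data.Integer.Properties as ℤ
open import Data.List using (List; []; _∷_; cartesianProductWith; cartesianProduct; filter)
import Data.List.Extrema
open import Data.List.Membership.Propositional using () renaming (_∈_ to _∈ᴸ_)
open import Data.List.Membership.Propositional.Properties using (∈-cartesianProductWith⁺; ∈-cartesianProduct⁺; ∈-filter⁺)
open import Data.List.Relation.Unary.All using (lookup)
open import Data.List.Relation.Unary.All.Properties using (all-filter)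
open import Data.List.Relation.Unary.Any using (here; there)
open import Data.Maybe using (Maybe; just; nothing)
open import Data.Maybe.Properties using (just-injective)
open import Data.Nat using (ℕ; zero; suc; _≥_)
import Data.Nat as ℕ
import Data.Nat.Properties as ℕ
import Data.Nat.Solver as ℕSolver
open import Data.Product using (_×_; _,_; ∃-syntax; Σ-syntax; proj₁; proj₂; map₁)
open import Data.Product.Function.NonDependent.Propositional using (_×-↔_)
open import Data.Rational hiding (_≟_; _≥_)
open import Data.Rational.Properties hiding (_≟_)
import Data.Rational.Properties as ℚ
open import Data.Rational.Solver using (module +-*-Solver)
import Data.Rational.Unnormalised as ℚᵘ
import Data.Rational.Unnormalised.Properties as ℚᵘ
open import Data.Sum using (_⊎_; inj₁; inj₂; [_,_]′)
import Data.Sum as Sum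
open import Data.Sum.Function.Propositional using (_⊎-↔_)
open import Data.Unit using (⊤; tt)
open import Data.Vec using (Vec; []; _∷_; tabulate) renaming (lookup to _‼_)
open import Data.Vec.Properties using (lookup∘tabulate)
open import Function using (_∘_; _↔_; Inverse; Injective)
open import Function.Construct.Composition using (_↔-∘_)
open import Function.Construct.Identity using (↔-id)
open import Level using (0ℓ)
open import Relation.Binary using (Rel; Decidable; DecidableEquality; DecTotalOrder)
open import Relation.Binary.Construct.Closure.Transitive using (TransClosure; [_]; _∷_)
open import Relation.Binary.PropositionalEquality
open import Relation.Nullary using (Dec; yes; no; does; ¬_; contradiction; ¬?; _×-dec_; _→-dec_; map′)
open import Relation.Nullary.Decidable using (dec-true; dec-false; decidable-stable)

module ∑ₚ = CMSum +-0-commutativeMonoid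
module ∑ₛ = SRSum (CommutativeRing.semiring +-*-commutativeRing)

private
  variable
    n : ℕ
    A B : Set

-- Order and arithmetic of the rationals.

2ℚ : ℚ
2ℚ = ℤ.+ 2 / 1

0≤1 : 0ℚ ≤ 1ℚ
0≤1 = nonNegative⁻¹ 1ℚ

+-nonneg : ∀ {p q} → 0ℚ ≤ p → 0ℚ ≤ q → 0ℚ ≤ p + q
+-nonneg = +-mono-≤

p≤p+q : ∀ {p q} → 0ℚ ≤ q → p ≤ p + q
p≤p+q {p} {q} 0≤q = subst (_≤ p + q) (+-identityʳ p) (+-monoʳ-≤ p 0≤q)

p≤q+p : ∀ {p q} → 0ℚ ≤ q → p ≤ q + p
p≤q+p {p} {q} 0≤q = subst (_≤ q + p) (+-identityˡ p) (+-monoˡ-≤ p 0≤q)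

*-monoˡ : ∀ {p q} r → 0ℚ ≤ r → p ≤ q → r * p ≤ r * q
*-monoˡ r 0≤r = *-monoˡ-≤-nonNeg r {{nonNegative 0≤r}}

*-monoʳ : ∀ {p q} r → 0ℚ ≤ r → p ≤ q → p * r ≤ q * r
*-monoʳ r 0≤r = *-monoʳ-≤-nonNeg r {{nonNegative 0≤r}}

*-nonneg : ∀ {p q} → 0ℚ ≤ p → 0ℚ ≤ q → 0ℚ ≤ p * q
*-nonneg {p} {q} 0≤p 0≤q = subst (_≤ p * q) (*-zeroʳ p) (*-monoˡ p 0≤p 0≤q)

only-if : Bool → ℚ → ℚ
only-if b x = if b then x else 0ℚ

only-if-nonneg : ∀ b {x} → 0ℚ ≤ x → 0ℚ ≤ only-if b x
only-if-nonneg true  0≤x = 0≤x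
only-if-nonneg false 0≤x = ≤-refl

only-if-≤ : ∀ b {x} → 0ℚ ≤ x → only-if b x ≤ x
only-if-≤ true  0≤x = ≤-refl
only-if-≤ false 0≤x = 0≤x

-- Finite sums

∑-cong : ∀ {f g : Fin n → ℚ} → (∀ i → f i ≡ g i) → ∑ f ≡ ∑ g
∑-cong = ∑ₚ.sum-cong-≗

∑-mono : ∀ {f g : Fin n → ℚ} → (∀ i → f i ≤ g i) → ∑ f ≤ ∑ g
∑-mono {zero}  f≤g = ≤-refl
∑-mono {suc n} f≤g = +-mono-≤ (f≤g zero) (∑-mono (f≤g ∘ suc))

∑-zero : ∀ n → ∑ {n} (λ _ → 0ℚ) ≡ 0ℚ
∑-zero n = ∑ₚ.sum-replicate-zero n

∑-nonneg : ∀ {f : Fin n → ℚ} → (∀ i → 0ℚ ≤ f i) → 0ℚ ≤ ∑ f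
∑-nonneg {n} {f} 0≤f = subst (_≤ ∑ f) (∑-zero n) (∑-mono 0≤f)

∑-only : ∀ (j : Fin n) (f : Fin n → ℚ) → ∑ (λ i → only-if (does (i Fin.≟ j)) (f i)) ≡ f j
∑-only {suc n} zero    f = trans (cong (f zero +_) (∑-zero n)) (+-identityʳ _)
∑-only {suc n} (suc j) f = trans (+-identityˡ _) (∑-only j (f ∘ suc))

-- Induction on `m`: the term at `e zero` is split off on both sides, and `punchOut` sends the
-- remaining indices injectively into those other than `e zero`.
∑-injective-≤ : ∀ {m n} (f : Fin n → ℚ) → (∀ i → 0ℚ ≤ f i) →
                (e : Fin m → Fin n) → Injective _≡_ _≡_ e → ∑ (f ∘ e) ≤ ∑ f
∑-injective-≤ {zero}          f 0≤f e inj = ∑-nonneg 0≤f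
∑-injective-≤ {suc m} {zero}  f 0≤f e inj = ⊥-elim (Fin.¬Fin0 (e zero))
∑-injective-≤ {suc m} {suc n} f 0≤f e inj =
  subst (∑ (f ∘ e) ≤_) (sym (∑ₚ.sum-remove f))
    (+-monoʳ-≤ (f (e zero))
      (subst (_≤ _) (∑-cong λ i → cong f (Fin.punchIn-punchOut (e0≢ i)))
        (∑-injective-≤ (f ∘ punchIn (e zero)) (0≤f ∘ punchIn (e zero)) e′
          (λ eq → Fin.suc-injective (inj (Fin.punchOut-injective (e0≢ _) (e0≢ _) eq))))))
  where
  e0≢ : ∀ i → e zero ≢ e (suc i)
  e0≢ i eq = Fin.0≢1+n (inj eq)
  e′ : Fin m → Fin n
  e′ i = punchOut (e0≢ i)

-- Double counting over the pairs `(i , j)` with `e j ≡ i`: a nonzero `f i` is met at least once,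
-- and each `j` contributes exactly `f (e j)`. Repeated values of `e` only enlarge the right side.
∑-cover-≤ : ∀ {m n} (f : Fin n → ℚ) → (∀ i → 0ℚ ≤ f i) → (e : Fin m → Fin n) →
            (∀ i → f i ≡ 0ℚ ⊎ (∃[ j ] e j ≡ i)) → ∑ f ≤ ∑ (f ∘ e)
∑-cover-≤ {m} {n} f 0≤f e cover = begin
  ∑ f                                                      ≤⟨ ∑-mono below ⟩
  ∑ (λ i → ∑ λ j → only-if (does (i Fin.≟ e j)) (f i))     ≡⟨ ∑ₚ.∑-comm {n} {m} _ ⟩
  ∑ (λ j → ∑ λ i → only-if (does (i Fin.≟ e j)) (f i))     ≡⟨ ∑-cong (λ j → ∑-only (e j) f) ⟩
  ∑ (f ∘ e)                                                ∎
  where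
  open ≤-Reasoning
  below : ∀ i → f i ≤ ∑ λ j → only-if (does (i Fin.≟ e j)) (f i)
  below i with cover i
  ... | inj₁ fi≡0 = ≤-trans (≤-reflexive fi≡0) (∑-nonneg λ j → only-if-nonneg (does (i Fin.≟ e j)) (0≤f i))
  ... | inj₂ (j , refl) = begin
    f (e j)
      ≡⟨ cong (λ b → only-if b (f (e j))) (dec-true (e j Fin.≟ e j) refl) ⟨
    only-if (does (e j Fin.≟ e j)) (f (e j))
      ≡⟨ ∑-only j (λ l → only-if (does (e j Fin.≟ e l)) (f (e j))) ⟨
    -- The term is written as a sum in which only the index `j` survives; lifting that restriction
    -- adds nonnegative terms.
    ∑ (λ l → only-if (does (l Fin.≟ j)) (only-if (does (e j Fin.≟ e l)) (f (e j))))
      ≤⟨ ∑-mono (λ l → only-if-≤ (does (l Fin.≟ j)) (only-if-nonneg _ (0≤f (e j)))) ⟩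
    ∑ (λ l → only-if (does (e j Fin.≟ e l)) (f (e j)))     ∎

∑-splitAt : ∀ m {n} (f : Fin m ⊎ Fin n → ℚ) → ∑ (f ∘ splitAt m) ≡ ∑ (f ∘ inj₁) + ∑ (f ∘ inj₂)
∑-splitAt zero    f = sym (+-identityˡ _)
∑-splitAt (suc m) {n} f = begin
  f (inj₁ zero) + ∑ (f ∘ splitAt (suc m) ∘ suc)
    ≡⟨ cong (f (inj₁ zero) +_) (∑-cong {m ℕ.+ n} λ i → shift (splitAt m i)) ⟩
  f (inj₁ zero) + ∑ (f′ ∘ splitAt m)
    ≡⟨ cong (f (inj₁ zero) +_) (∑-splitAt m f′) ⟩
  f (inj₁ zero) + (∑ (f ∘ inj₁ ∘ suc) + ∑ (f ∘ inj₂))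
    ≡⟨ +-assoc (f (inj₁ zero)) (∑ (f ∘ inj₁ ∘ suc)) (∑ (f ∘ inj₂)) ⟨
  ∑ (f ∘ inj₁) + ∑ (f ∘ inj₂) ∎
  where
  open ≡-Reasoning
  f′ : Fin m ⊎ Fin n → ℚ
  f′ = [ f ∘ inj₁ ∘ suc , f ∘ inj₂ ]′
  shift : ∀ (x : Fin m ⊎ Fin n) → f (Sum.map₁ suc x) ≡ f′ x
  shift (inj₁ _) = refl
  shift (inj₂ _) = refl

∑-remQuot : ∀ m n (f : Fin m × Fin n → ℚ) → ∑ (f ∘ remQuot {m} n) ≡ ∑ λ i → ∑ λ j → f (i , j)
∑-remQuot zero    n f = refl
∑-remQuot (suc m) n f = begin
  ∑ (f ∘ remQuot {suc m} n)
    ≡⟨ ∑-cong {n ℕ.+ m ℕ.* n} (λ i → shift (splitAt n i) refl) ⟩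
  ∑ (f′ ∘ splitAt n)
    ≡⟨ ∑-splitAt n f′ ⟩
  ∑ (λ j → f (zero , j)) + ∑ (λ i → f (map₁ suc (remQuot {m} n i)))
    ≡⟨ cong (∑ (λ j → f (zero , j)) +_) (∑-remQuot m n (f ∘ map₁ suc)) ⟩
  (∑ λ i → ∑ λ j → f (i , j)) ∎
  where
  open ≡-Reasoning
  f′ : Fin n ⊎ Fin (m ℕ.* n) → ℚ
  f′ = [ (λ j → f (zero , j)) , f ∘ map₁ suc ∘ remQuot {m} n ]′
  shift : ∀ {i} (x : Fin n ⊎ Fin (m ℕ.* n)) → splitAt n i ≡ x → f (remQuot {suc m} n i) ≡ f′ x
  shift (inj₁ _) eq rewrite eq = refl
  shift (inj₂ _) eq rewrite eq = refl

-- Finite types and sums over them.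

record Finite (A : Set) : Set where
  field
    size : ℕ
    iso  : Fin size ↔ A
  open Inverse iso public using (to; from; strictlyInverseˡ; strictlyInverseʳ)

  from-injective : Injective _≡_ _≡_ from
  from-injective {x} {y} eq = trans (sym (strictlyInverseˡ x)) (trans (cong to eq) (strictlyInverseˡ y))

  to-injective : Injective _≡_ _≡_ to
  to-injective {x} {y} eq = trans (sym (strictlyInverseʳ x)) (trans (cong from eq) (strictlyInverseʳ y))

  infix 4 _≟_
  _≟_ : DecidableEquality A
  x ≟ y with from x Fin.≟ from y
  ... | yes eq = yes (from-injective eq)
  ... | no ¬eq = no (¬eq ∘ cong from)

finFinite : ∀ n → Finite (Fin n)
finFinite n = record { size = n ; iso = ↔-id _ }

⊤-finite : Finite ⊤
⊤-finite = record { size = 1 ; iso = Fin.1↔⊤ }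

_⊎-finite_ : Finite A → Finite B → Finite (A ⊎ B)
F ⊎-finite G = record { size = Finite.size F ℕ.+ Finite.size G ; iso = (Finite.iso F ⊎-↔ Finite.iso G) ↔-∘ Fin.+↔⊎ }

_×-finite_ : Finite A → Finite B → Finite (A × B)
F ×-finite G = record { size = Finite.size F ℕ.* Finite.size G ; iso = (Finite.iso F ×-↔ Finite.iso G) ↔-∘ Fin.*↔× }

∑[_] : Finite A → (A → ℚ) → ℚ
∑[ F ] f = ∑ (f ∘ Finite.to F)

∑-⊎ : ∀ (F : Finite A) (G : Finite B) f → ∑[ F ⊎-finite G ] f ≡ ∑[ F ] (f ∘ inj₁) + ∑[ G ] (f ∘ inj₂)
∑-⊎ F G f = trans (∑-cong {Finite.size F ℕ.+ Finite.size G} λ i → pt (splitAt (Finite.size F) i)) (∑-splitAt (Finite.size F) f′)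
  where
  f′ : Fin (Finite.size F) ⊎ Fin (Finite.size G) → ℚ
  f′ = [ f ∘ inj₁ ∘ Finite.to F , f ∘ inj₂ ∘ Finite.to G ]′
  pt : ∀ x → f (Inverse.to (Finite.iso F ⊎-↔ Finite.iso G) x) ≡ f′ x
  pt (inj₁ _) = refl
  pt (inj₂ _) = refl

∑-× : ∀ (F : Finite A) (G : Finite B) f → ∑[ F ×-finite G ] f ≡ ∑[ F ] λ a → ∑[ G ] λ b → f (a , b)
∑-× F G f = ∑-remQuot (Finite.size F) (Finite.size G) (λ (i , j) → f (Finite.to F i , Finite.to G j))

∑-⊤ : ∀ f → ∑[ ⊤-finite ] f ≡ f tt
∑-⊤ f = +-identityʳ _

∑-from : ∀ (F : Finite A) (f : Fin (Finite.size F) → ℚ) → ∑ f ≡ ∑[ F ] (f ∘ Finite.from F)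
∑-from F f = ∑-cong λ i → cong f (sym (Finite.strictlyInverseʳ F i))

module _ (F : Finite A) (G : Finite B) (e : A → B) (f : B → ℚ) (0≤f : ∀ b → 0ℚ ≤ f b) where
  private
    module F = Finite F
    module G = Finite G
    along : ∑[ F ] (f ∘ e) ≡ ∑ (λ i → f (G.to (G.from (e (F.to i)))))
    along = ∑-cong λ i → cong f (sym (G.strictlyInverseˡ (e (F.to i))))

  ∑[]-injective-≤ : Injective _≡_ _≡_ e → ∑[ F ] (f ∘ e) ≤ ∑[ G ] f
  ∑[]-injective-≤ inj = subst (_≤ _) (sym along)
    (∑-injective-≤ (f ∘ G.to) (0≤f ∘ G.to) (G.from ∘ e ∘ F.to)
      (F.to-injective ∘ inj ∘ G.from-injective))

  ∑[]-cover-≤ : (∀ b → f b ≡ 0ℚ ⊎ (∃[ a ] e a ≡ b)) → ∑[ G ] f ≤ ∑[ F ] (f ∘ e)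
  ∑[]-cover-≤ cover = subst (_ ≤_) (sym along)
    (∑-cover-≤ (f ∘ G.to) (0≤f ∘ G.to) (G.from ∘ e ∘ F.to) cov)
    where
    cov : ∀ i → f (G.to i) ≡ 0ℚ ⊎ (∃[ j ] G.from (e (F.to j)) ≡ i)
    cov i with cover (G.to i)
    ... | inj₁ eq = inj₁ eq
    ... | inj₂ (a , eq) = inj₂ (F.from a ,
      trans (cong (G.from ∘ e) (F.strictlyInverseˡ a)) (trans (cong G.from eq) (G.strictlyInverseʳ i)))

-- Cancellation, and sums masked by a Boolean.

+-cancelˡ-≤ : ∀ r {p q} → r + p ≤ r + q → p ≤ q
+-cancelˡ-≤ r {p} {q} h = subst₂ _≤_ (unshift p) (unshift q) (+-monoʳ-≤ (- r) h)
  where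
  unshift : ∀ x → - r + (r + x) ≡ x
  unshift x = trans (sym (+-assoc (- r) r x)) (trans (cong (_+ x) (+-inverseˡ r)) (+-identityˡ x))

only-if-∧ : ∀ b c {x} → only-if (b ∧ c) x ≡ only-if c (only-if b x)
only-if-∧ true  c     = refl
only-if-∧ false true  = refl
only-if-∧ false false = refl

∑-only-if : ∀ {n} b (f : Fin n → ℚ) → ∑ (λ i → only-if b (f i)) ≡ only-if b (∑ f)
∑-only-if {n} true  f = refl
∑-only-if {n} false f = ∑-zero n

∑-split : ∀ {n} (j : Fin n) (f : Fin n → ℚ) →
          ∑ f ≡ ∑ (λ i → only-if (not (does (i Fin.≟ j))) (f i)) + f j
∑-split j f = begin
  ∑ f                                             ≡⟨ ∑-cong (λ i → by (does (i Fin.≟ j))) ⟩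
  ∑ (λ i → only-if (not (does (i Fin.≟ j))) (f i) + only-if (does (i Fin.≟ j)) (f i))
                                                  ≡⟨ ∑ₚ.∑-distrib-+ (λ i → only-if (not (does (i Fin.≟ j))) (f i)) _ ⟩
  others + ∑ (λ i → only-if (does (i Fin.≟ j)) (f i))
                                                  ≡⟨ cong (others +_) (∑-only j f) ⟩
  others + f j                                    ∎
  where
  open ≡-Reasoning
  others = ∑ λ i → only-if (not (does (i Fin.≟ j))) (f i)
  by : ∀ b {x} → x ≡ only-if (not b) x + only-if b x
  by true  {x} = sym (+-identityˡ x)
  by false {x} = sym (+-identityʳ x)

-- Flows in a digraph

crosses : ∀ {n} → Subset n → Fin n → Fin n → Bool
crosses S t h = does (t ∈? S) ∧ not (does (h ∈? S))

module Flow {n} (G : Digraph n) (X : Fin n → Fin n → ℚ) where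
  open Digraph G

  -- Extension of `X` by zero to pairs that are not arcs, which turns the sums over arc sets into
  -- plain sums.
  flow : Fin n → Fin n → ℚ
  flow t h = only-if (does (arc? t h)) (X t h)

  inflow : ∀ u → ∑ᴬ (δin G u) X ≡ ∑ λ t → flow t u
  inflow u = ∑-cong λ t → trans
    (∑-cong λ h → only-if-∧ (does (arc? t h)) (does (h Fin.≟ u)))
    (∑-only u (flow t))

  outflow : ∀ u → ∑ᴬ (δout G u) X ≡ ∑ (flow u)
  outflow u = trans
    (∑-cong λ t → trans
      (∑-cong λ h → only-if-∧ (does (arc? t h)) (does (t Fin.≟ u)))
      (∑-only-if (does (t Fin.≟ u)) (flow t)))
    (∑-only u (∑ ∘ flow))

  cutflow : ∀ S → ∑ᴬ (δoutˢ G S) X ≡ ∑ λ t → ∑ λ h → only-if (crosses S t h) (flow t h)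
  cutflow S = ∑-cong λ t → ∑-cong λ h → only-if-∧ (does (arc? t h)) (crosses S t h)

module Constraints {n} {G : Digraph n} {r : Fin n} {a : Assignment n} (feasible : LPFeasible G r a) where
  open Digraph G
  open Assignment a
  open LPFeasible feasible
  open Flow G X public

  flow-nonneg : ∀ t h → 0ℚ ≤ flow t h
  flow-nonneg t h with arc? t h
  ... | yes arc = proj₁ (X-bounds arc)
  ... | no  _   = ≤-refl

  flow-off : ∀ {t h} → ¬ Arc t h → flow t h ≡ 0ℚ
  flow-off {t} {h} ¬arc = cong (λ b → only-if b (X t h)) (dec-false (arc? t h) ¬arc)

  -- The cut {t, h} is left by all arcs out of t and h except t → h itself.
  flow≤Y : ∀ {t h} → t ≢ r → h ≢ r → flow t h ≤ Y h
  flow≤Y {t} {h} t≢r h≢r = +-cancelˡ-≤ others (begin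
    others + flow t h                      ≡⟨ ∑-split h (flow t) ⟨
    ∑ (flow t)                             ≡⟨ outflow t ⟨
    ∑ᴬ (δout G t) X                        ≡⟨ out-degree t t≢r ⟩
    Y t                                    ≤⟨ connectivity S r∉S t t∈S ⟩
    ∑ᴬ (δoutˢ G S) X                       ≡⟨ cutflow S ⟩
    ∑ (λ s → ∑ λ v → only-if (crosses S s v) (flow s v))
                                           ≤⟨ ∑-mono row ⟩
    ∑ (λ s → only-if (does (s Fin.≟ t)) (rest s) + only-if (does (s Fin.≟ h)) (∑ (flow s)))
                                           ≡⟨ ∑ₚ.∑-distrib-+ (λ s → only-if (does (s Fin.≟ t)) (rest s)) _ ⟩
    ∑ (λ s → only-if (does (s Fin.≟ t)) (rest s)) + ∑ (λ s → only-if (does (s Fin.≟ h)) (∑ (flow s)))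
                                           ≡⟨ cong₂ _+_ (∑-only t rest) (∑-only h (∑ ∘ flow)) ⟩
    others + ∑ (flow h)                    ≡⟨ cong (others +_) (outflow h) ⟨
    others + ∑ᴬ (δout G h) X               ≡⟨ cong (others +_) (out-degree h h≢r) ⟩
    others + Y h                           ∎)
    where
    open ≤-Reasoning
    S = ⁅ t ⁆ ∪ ⁅ h ⁆
    rest : Fin n → ℚ
    rest s = ∑ λ v → only-if (not (does (v Fin.≟ h))) (flow s v)
    others = rest t
    t∈S : t ∈ S
    t∈S = x∈p∪q⁺ {p = ⁅ t ⁆} (inj₁ (x∈⁅x⁆ t))
    h∈S : h ∈ S
    h∈S = x∈p∪q⁺ {p = ⁅ t ⁆} (inj₂ (x∈⁅x⁆ h))
    only-two : ∀ {v} → v ∈ S → v ≡ t ⊎ v ≡ h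
    only-two v∈S = [ inj₁ ∘ x∈⁅y⁆⇒x≡y _ , inj₂ ∘ x∈⁅y⁆⇒x≡y _ ]′ (x∈p∪q⁻ ⁅ t ⁆ ⁅ h ⁆ v∈S)
    r∉S : r ∉ S
    r∉S r∈S = [ t≢r ∘ sym , h≢r ∘ sym ]′ (only-two r∈S)
    rest-nonneg : ∀ s → 0ℚ ≤ rest s
    rest-nonneg s = ∑-nonneg λ v → only-if-nonneg (not (does (v Fin.≟ h))) (flow-nonneg s v)
    total-nonneg : ∀ s → 0ℚ ≤ ∑ (flow s)
    total-nonneg s = ∑-nonneg (flow-nonneg s)
    cell : ∀ s v → only-if (crosses S s v) (flow s v) ≤ only-if (not (does (v Fin.≟ h))) (flow s v)
    cell s v with v Fin.≟ h | s ∈? S | v ∈? S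
    ... | yes refl | yes _ | yes _   = ≤-refl
    ... | yes refl | yes _ | no h∉S  = contradiction h∈S h∉S
    ... | yes refl | no _  | _       = ≤-refl
    ... | no _     | yes _ | yes _   = flow-nonneg s v
    ... | no _     | yes _ | no _    = ≤-refl
    ... | no _     | no _  | _       = flow-nonneg s v
    row : ∀ s → ∑ (λ v → only-if (crosses S s v) (flow s v)) ≤
                only-if (does (s Fin.≟ t)) (rest s) + only-if (does (s Fin.≟ h)) (∑ (flow s))
    row s with s Fin.≟ t | s Fin.≟ h
    ... | yes _ | q     = ≤-trans (∑-mono (cell s)) (p≤p+q (only-if-nonneg (does q) (total-nonneg s)))
    ... | no _  | yes _ = ≤-trans (∑-mono (λ v → only-if-≤ (crosses S s v) (flow-nonneg s v)))
                            (≤-reflexive (sym (+-identityˡ _)))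
    ... | no ¬t | no ¬h = ≤-reflexive (trans (∑-cong outside) (∑-zero n))
      where
      outside : ∀ v → only-if (crosses S s v) (flow s v) ≡ 0ℚ
      outside v rewrite dec-false (s ∈? S) ([ ¬t , ¬h ]′ ∘ only-two) = refl

-- Vertices are kept in a structured type `V`, while `Digraph` asks for `Fin n`. `Bounds` carries
-- the constraints from `Fin` to `V`, `Solution` carries them back.
module Encoded {V : Set} (F : Finite V) {Edge : Rel V 0ℓ} (edge? : Decidable Edge) where
  open Finite F

  graph : Digraph size
  graph = record { Arc = λ t h → Edge (to t) (to h) ; arc? = λ t h → edge? (to t) (to h) }

  module Bounds {root : V} {a : Assignment size} (feasible : LPFeasible graph (from root) a) where
    open LPFeasible feasible
    open Constraints feasible

    y : V → ℚ
    y v = Assignment.Y a (from v)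

    ϕ : V → V → ℚ
    ϕ t h = flow (from t) (from h)

    y-nonneg : ∀ v → 0ℚ ≤ y v
    y-nonneg v = proj₁ (Y-bounds (from v))

    y≤1 : ∀ v → y v ≤ 1ℚ
    y≤1 v = proj₂ (Y-bounds (from v))

    ϕ-nonneg : ∀ t h → 0ℚ ≤ ϕ t h
    ϕ-nonneg t h = flow-nonneg (from t) (from h)

    ϕ-off : ∀ {t h} → ¬ Edge t h → ϕ t h ≡ 0ℚ
    ϕ-off {t} {h} ¬edge =
      flow-off (¬edge ∘ subst₂ Edge (strictlyInverseˡ t) (strictlyInverseˡ h))

    ϕ-in : ∀ h → ∑[ F ] (λ t → ϕ t h) ≤ 2ℚ * y h
    ϕ-in h = subst (_≤ _) (trans (inflow (from h)) (∑-from F _)) (in-degree (from h))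

    ϕ-out : ∀ {t} → t ≢ root → ∑[ F ] (ϕ t) ≡ y t
    ϕ-out {t} t≢root = trans (sym (trans (outflow (from t)) (∑-from F _)))
      (out-degree (from t) (t≢root ∘ from-injective))

    ϕ≤y : ∀ {t h} → t ≢ root → h ≢ root → ϕ t h ≤ y h
    ϕ≤y t≢root h≢root = flow≤Y (t≢root ∘ from-injective) (h≢root ∘ from-injective)

    objective≡ : objective a ≡ ∑[ F ] y
    objective≡ = ∑-from F _

  module Solution (root : V) (Yᵛ : V → ℚ) (Xᵛ : V → V → ℚ) where

    ϕ : V → V → ℚ
    ϕ t h = only-if (does (edge? t h)) (Xᵛ t h)

    cut : (V → Bool) → ℚ
    cut s = ∑[ F ] λ t → ∑[ F ] λ h → only-if (s t ∧ not (s h)) (ϕ t h)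

    assignment : Assignment size
    assignment = record { Y = Yᵛ ∘ to ; X = λ t h → Xᵛ (to t) (to h) }

    -- Cuts are Boolean predicates on `V` and the bounds on `Xᵛ` range over all pairs, so that no
    -- index of the encoding occurs in what has to be shown.
    feasible : (∀ v → ∑[ F ] (λ t → ϕ t v) ≤ 2ℚ * Yᵛ v) →
               (∀ v → v ≢ root → ∑[ F ] (ϕ v) ≡ Yᵛ v) →
               (∀ s → s root ≡ false → ∀ v → s v ≡ true → Yᵛ v ≤ cut s) →
               (∀ v → 0ℚ ≤ Yᵛ v × Yᵛ v ≤ 1ℚ) →
               (∀ t h → 0ℚ ≤ Xᵛ t h × Xᵛ t h ≤ 1ℚ) →
               LPFeasible graph (from root) assignment
    feasible ins outs cuts Ybounds Xbounds = record
      { in-degree    = λ u → ≤-trans (≤-reflexive (inflow u)) (ins (to u))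
      ; out-degree   = λ u u≢r → trans (outflow u)
          (outs (to u) λ eq → u≢r (trans (sym (strictlyInverseʳ u)) (cong from eq)))
      ; connectivity = λ S r∉S u u∈S → subst (Yᵛ (to u) ≤_) (sym (trans (cutflow S) (cut≡ S)))
          (cuts (λ v → does (from v ∈? S)) (dec-false (_ ∈? S) r∉S) (to u)
            (dec-true (_ ∈? S) (subst (_∈ S) (sym (strictlyInverseʳ u)) u∈S)))
      ; Y-bounds     = Ybounds ∘ to
      ; X-bounds     = λ {t} {h} _ → Xbounds (to t) (to h)
      }
      where
      open Flow graph (Assignment.X assignment)
      cut≡ : ∀ S → ∑ (λ t → ∑ λ h → only-if (crosses S t h) (flow t h)) ≡
                   cut (λ v → does (from v ∈? S))
      cut≡ S = ∑-cong λ t → ∑-cong λ h → cong₂ (λ i j → only-if (crosses S i j) (flow t h))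
                 (sym (strictlyInverseʳ t)) (sym (strictlyInverseʳ h))

-- Sums with at most one nonzero term, and paths.

2*p≡p+p : ∀ p → 2ℚ * p ≡ p + p
2*p≡p+p p = trans (*-distribʳ-+ p 1ℚ 1ℚ) (cong₂ _+_ (*-identityˡ p) (*-identityˡ p))

any? : (F : Finite A) {P : A → Set} → (∀ a → Dec (P a)) → Dec (∃[ a ] P a)
any? F {P} P? with Fin.any? (P? ∘ Finite.to F)
... | yes (i , p) = yes (Finite.to F i , p)
... | no ¬p = no λ (a , p) → ¬p (Finite.from F a , subst P (sym (Finite.strictlyInverseˡ F a)) p)

-- The sum is empty or reduces to one term. This bounds in-flows, since most vertices have only one
-- in-neighbour of each sort.
∑-at-most-one : (F : Finite A) {f : A → ℚ} {c : ℚ} {P : A → Set} →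
                0ℚ ≤ c → (∀ a → 0ℚ ≤ f a) → (∀ a → f a ≤ c) →
                (∀ a → Dec (P a)) → (∀ {a} → ¬ P a → f a ≡ 0ℚ) → (∀ {a b} → P a → P b → a ≡ b) →
                ∑[ F ] f ≤ c
∑-at-most-one F {f} {c} 0≤c 0≤f f≤c P? off unique with any? F P?
... | no none = ≤-trans
  (∑[]-cover-≤ (finFinite 0) F (λ ()) f 0≤f λ a → inj₁ (off λ p → none (a , p))) 0≤c
... | yes (a , p) = ≤-trans
  (∑[]-cover-≤ ⊤-finite F (λ _ → a) f 0≤f cover) (≤-trans (≤-reflexive (∑-⊤ (λ _ → f a))) (f≤c a))
  where
  cover : ∀ b → f b ≡ 0ℚ ⊎ (∃[ _ ] a ≡ b)
  cover b with P? b
  ... | yes q = inj₂ (tt , unique p q)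
  ... | no ¬q = inj₁ (off ¬q)

-- The predecessor of f i on the path a, f 0, f 1, ….
prev : A → (Fin n → A) → Fin n → A
prev a f zero    = a
prev a f (suc i) = f (inject₁ i)

-- `prev a f i` is stuck on a variable `i`, so a property of it is proved once for the start and
-- once for all other vertices of the path.
prev-elim : ∀ {a : A} {f : Fin n → A} (P : A → Set) → P a → (∀ i → P (f i)) → ∀ i → P (prev a f i)
prev-elim P pa pf zero    = pa
prev-elim P pa pf (suc i) = pf (inject₁ i)

prev-injective : ∀ {a : A} {f : Fin n → A} → Injective _≡_ _≡_ f → (∀ i → a ≢ f i) →
                 Injective _≡_ _≡_ (prev a f)
prev-injective inj a≢f {zero}  {zero}  eq = refl
prev-injective inj a≢f {zero}  {suc j} eq = contradiction eq (a≢f _)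
prev-injective inj a≢f {suc i} {zero}  eq = contradiction (sym eq) (a≢f _)
prev-injective inj a≢f {suc i} {suc j} eq = cong suc (Fin.inject₁-injective (inj eq))

chain-induction : ∀ {a : A} {f : Fin n → A} (P : A → Set) →
                  P a → (∀ i → P (prev a f i) → P (f i)) → ∀ i → P (f i)
chain-induction {n = suc n} {f = f} P pa step =
  <-weakInduction (P ∘ f) (step zero pa) (λ i → step (suc i))

-- The gadget

module Gadget (k W K ℓ : ℕ) where

  -- In order: the spine vertex, the start of the trunk, the other trunk vertices, the links, the
  -- items, and the tail vertices behind each item.
  Group : Set
  Group = ⊤ ⊎ (⊤ ⊎ (Fin W ⊎ (Fin W ⊎ (Fin K ⊎ (Fin K × Fin ℓ)))))

  V : Set
  V = (⊤ ⊎ (⊤ ⊎ ⊤)) ⊎ (Fin k × Group)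

  pattern root         = inj₁ (inj₁ tt)
  pattern hub          = inj₁ (inj₂ (inj₁ tt))
  pattern origin       = inj₁ (inj₂ (inj₂ tt))
  pattern spine g      = inj₂ (g , inj₁ tt)
  pattern trunk₀ g     = inj₂ (g , inj₂ (inj₁ tt))
  pattern trunk g i    = inj₂ (g , inj₂ (inj₂ (inj₁ i)))
  pattern link g i     = inj₂ (g , inj₂ (inj₂ (inj₂ (inj₁ i))))
  pattern item g j     = inj₂ (g , inj₂ (inj₂ (inj₂ (inj₂ (inj₁ j)))))
  pattern tail g j l   = inj₂ (g , inj₂ (inj₂ (inj₂ (inj₂ (inj₂ (j , l))))))

  Group-finite : Finite Group
  Group-finite = ⊤-finite ⊎-finite (⊤-finite ⊎-finite (finFinite W ⊎-finite (finFinite W ⊎-finite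
    (finFinite K ⊎-finite (finFinite K ×-finite finFinite ℓ)))))

  V-finite : Finite V
  V-finite = (⊤-finite ⊎-finite (⊤-finite ⊎-finite ⊤-finite)) ⊎-finite (finFinite k ×-finite Group-finite)

  open Finite V-finite using (_≟_)

  spineBefore : Fin k → V
  spineBefore = prev origin λ g → spine g

  trunkBefore : Fin k → Fin W → V
  trunkBefore g = prev (trunk₀ g) λ i → trunk g i

  tailBefore : Fin k → Fin K → Fin ℓ → V
  tailBefore g j = prev (item g j) λ l → tail g j l

  degree : V → ℕ
  degree root       = 0
  degree (link _ _) = 2
  degree (item _ _) = W
  degree _          = 1

  -- Numbering the arcs by their tail makes the out-flow of a vertex a sum over `Fin (degree v)`.
  -- The second arc of a link enters the spine at the very vertex that `spine g` points to, so both
  -- compete for its in-capacity.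
  head : ∀ v → Fin (degree v) → V
  head hub          _       = root
  head origin       _       = root
  head (spine g)    _       = spineBefore g
  head (trunk₀ g)   _       = hub
  head (trunk g i)  _       = trunkBefore g i
  head (link g i)   zero    = trunk g i
  head (link g i)   (suc _) = spineBefore g
  head (item g j)   i       = link g i
  head (tail g j l) _       = tailBefore g j l

  Edge : Rel V 0ℓ
  Edge t h = ∃[ i ] head t i ≡ h

  -- Abstract because unfolding it lets the encoding of vertices leak into goals.
  abstract
    edge? : Decidable Edge
    edge? t h = Fin.any? λ i → head t i ≟ h

  open Encoded V-finite edge? public using (graph)

  -- A potential that decreases strictly along arcs, whence acyclicity. Links are placed above all
  -- trunk and spine vertices, whose ranks stay below `3 + k + W`.
  rank : V → ℕ
  rank root         = 0
  rank hub          = 1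
  rank origin       = 1
  rank (spine g)    = 2 ℕ.+ toℕ g
  rank (trunk₀ g)   = 2
  rank (trunk g i)  = 3 ℕ.+ toℕ i
  rank (link g i)   = 3 ℕ.+ k ℕ.+ W
  rank (item g j)   = 4 ℕ.+ k ℕ.+ W
  rank (tail g j l) = 5 ℕ.+ k ℕ.+ W ℕ.+ toℕ l

  rank-prev : ∀ {m c a} {f : Fin m → V} → rank a ℕ.< c → (∀ i → rank (f i) ≡ c ℕ.+ toℕ i) →
              ∀ i → rank (prev a f i) ℕ.< c ℕ.+ toℕ i
  rank-prev {c = c} a<c rf zero    = subst (_ ℕ.<_) (sym (ℕ.+-identityʳ c)) a<c
  rank-prev {c = c} a<c rf (suc i) rewrite rf (inject₁ i) | Fin.toℕ-inject₁ i =
    ℕ.+-monoʳ-< c (ℕ.n<1+n _)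

  rank-head : ∀ t i → rank (head t i) ℕ.< rank t
  rank-head hub          _       = ℕ.s≤s ℕ.z≤n
  rank-head origin       _       = ℕ.s≤s ℕ.z≤n
  rank-head (spine g)    _       = rank-prev ℕ.≤-refl (λ _ → refl) g
  rank-head (trunk₀ g)   _       = ℕ.≤-refl
  rank-head (trunk g i)  _       = rank-prev ℕ.≤-refl (λ _ → refl) i
  rank-head (link g i)   zero    = ℕ.+-monoʳ-< 3 (ℕ.<-≤-trans (Fin.toℕ<n i) (ℕ.m≤n+m W k))
  rank-head (link g i)   (suc _) = ℕ.<-≤-trans (rank-prev ℕ.≤-refl (λ _ → refl) g)
    (ℕ.+-mono-≤ (ℕ.n≤1+n 2) (ℕ.≤-trans (ℕ.<⇒≤ (Fin.toℕ<n g)) (ℕ.m≤m+n k W)))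
  rank-head (item g j)   i       = ℕ.≤-refl
  rank-head (tail g j l) _       = rank-prev ℕ.≤-refl (λ _ → refl) l

  rank-edge : ∀ {t h} → Edge t h → rank h ℕ.< rank t
  rank-edge {t} (i , refl) = rank-head t i

  acyclic : Acyclic graph
  acyclic v cycle = ℕ.<-irrefl refl (descends cycle)
    where
    open Digraph graph
    open Finite V-finite using (to)
    descends : ∀ {t h} → TransClosure Arc t h → rank (to h) ℕ.< rank (to t)
    descends [ e ]    = rank-edge e
    descends (e ∷ es) = ℕ.<-trans (descends es) (rank-edge e)

  -- Distinct vertices of the paths have distinct successors.

  spineBefore-injective : Injective _≡_ _≡_ spineBefore
  spineBefore-injective = prev-injective (λ { refl → refl }) (λ _ ())

  group : V → Maybe (Fin k)
  group (inj₁ _)       = nothing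
  group (inj₂ (g , _)) = just g

  -- Both vertices reveal their group, so `g` and `g′` agree first; matching on that equality leaves
  -- a single path, on which `prev` is injective.
  trunkBefore-injective : ∀ {g g′ i i′} → trunkBefore g i ≡ trunkBefore g′ i′ → (g , i) ≡ (g′ , i′)
  trunkBefore-injective {g} {g′} {i} {i′} eq = go (just-injective
      (trans (sym (group-before i)) (trans (cong group eq) (group-before i′)))) eq
    where
    group-before : ∀ {g} i → group (trunkBefore g i) ≡ just g
    group-before {g} = prev-elim (λ v → group v ≡ just g) refl (λ _ → refl)
    go : g ≡ g′ → trunkBefore g i ≡ trunkBefore g′ i′ → (g , i) ≡ (g′ , i′)
    go refl eq = cong (g ,_) (prev-injective (λ { refl → refl }) (λ _ ()) eq)

  itemOf : V → Maybe (Fin k × Fin K)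
  itemOf (item g j)   = just (g , j)
  itemOf (tail g j _) = just (g , j)
  itemOf _            = nothing

  tailBefore-injective : ∀ {g g′ j j′ l l′} → tailBefore g j l ≡ tailBefore g′ j′ l′ →
                         (g , j , l) ≡ (g′ , j′ , l′)
  tailBefore-injective {g} {g′} {j} {j′} {l} {l′} eq = go (just-injective
      (trans (sym (item-before l)) (trans (cong itemOf eq) (item-before l′)))) eq
    where
    item-before : ∀ {g j} l → itemOf (tailBefore g j l) ≡ just (g , j)
    item-before {g} {j} = prev-elim (λ v → itemOf v ≡ just (g , j)) refl (λ _ → refl)
    go : (g , j) ≡ (g′ , j′) → tailBefore g j l ≡ tailBefore g′ j′ l′ → (g , j , l) ≡ (g′ , j′ , l′)
    go refl eq = cong (λ l → g , j , l) (prev-injective (λ { refl → refl }) (λ _ ()) eq)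

  -- Heads of edges are values of prev, which cannot be matched on.  Recording the kind of the head as an index lets the
  -- possible tails at a given head be found by pattern matching on Into.
  data Kind : Set where
    rootᵏ hubᵏ spineᵏ trunkᵏ linkᵏ itemᵏ : Kind

  kind : V → Kind
  kind root         = rootᵏ
  kind hub          = hubᵏ
  kind origin       = spineᵏ
  kind (spine _)    = spineᵏ
  kind (trunk₀ _)   = trunkᵏ
  kind (trunk _ _)  = trunkᵏ
  kind (link _ _)   = linkᵏ
  kind (item _ _)   = itemᵏ
  kind (tail _ _ _) = itemᵏ

  data Into (h : V) : Kind → V → Set where
    via-hub    : Into h rootᵏ hub
    via-origin : Into h rootᵏ origin
    via-trunk₀ : ∀ g → Into h hubᵏ (trunk₀ g)
    via-spine  : ∀ g → spineBefore g ≡ h → Into h spineᵏ (spine g)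
    via-link↑  : ∀ g i → spineBefore g ≡ h → Into h spineᵏ (link g i)
    via-trunk  : ∀ g i → trunkBefore g i ≡ h → Into h trunkᵏ (trunk g i)
    via-link   : ∀ g i → trunk g i ≡ h → Into h trunkᵏ (link g i)
    via-item   : ∀ g j i → link g i ≡ h → Into h linkᵏ (item g j)
    via-tail   : ∀ g j l → tailBefore g j l ≡ h → Into h itemᵏ (tail g j l)

  into : ∀ {t h} → Edge t h → Into h (kind h) t
  into {hub}        (_ , refl)     = via-hub
  into {origin}     (_ , refl)     = via-origin
  into {trunk₀ g}   (_ , refl)     = via-trunk₀ g
  into {link g i}   (zero , refl)  = via-link g i refl
  into {item g j}   (i , refl)     = via-item g j i refl
  into {spine g}    (_ , refl)     = subst (λ c → Into (spineBefore g) c (spine g))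
    (sym (prev-elim (λ v → kind v ≡ spineᵏ) refl (λ _ → refl) g)) (via-spine g refl)
  into {link g i}   (suc _ , refl) = subst (λ c → Into (spineBefore g) c (link g i))
    (sym (prev-elim (λ v → kind v ≡ spineᵏ) refl (λ _ → refl) g)) (via-link↑ g i refl)
  into {trunk g i}  (_ , refl)     = subst (λ c → Into (trunkBefore g i) c (trunk g i))
    (sym (prev-elim (λ v → kind v ≡ trunkᵏ) refl (λ _ → refl) i)) (via-trunk g i refl)
  into {tail g j l} (_ , refl)     = subst (λ c → Into (tailBefore g j l) c (tail g j l))
    (sym (prev-elim (λ v → kind v ≡ itemᵏ) refl (λ _ → refl) l)) (via-tail g j l refl)

-- The fractional solution

-- `β` is the weight of every trunk, `τ` that of a link's arc into the spine and of an item's arc to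
-- a link. The sums say that `k` trunks fill the hub, that `W` arcs of weight `τ` make one unit, and
-- that `K` of them fit into a link of value `β + τ`.
module FractionalSolution (k W K ℓ : ℕ) (β τ : ℚ) (0≤β : 0ℚ ≤ β) (0≤τ : 0ℚ ≤ τ)
  (β+τ≤1 : β + τ ≤ 1ℚ) (∑β≡2 : ∑ {k} (λ _ → β) ≡ 2ℚ) (∑τ≡1 : ∑ {W} (λ _ → τ) ≡ 1ℚ)
  (∑τ≤ : ∑ {K} (λ _ → τ) ≤ 2ℚ * (β + τ)) where

  open Gadget k W K ℓ
  open Finite V-finite using (from; _≟_)

  Yᵛ : V → ℚ
  Yᵛ (trunk₀ _)  = β
  Yᵛ (trunk _ _) = β
  Yᵛ (link _ _)  = β + τ
  Yᵛ _           = 1ℚ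

  Xᵛ : V → V → ℚ
  Xᵛ (trunk₀ _)  _           = β
  Xᵛ (trunk _ _) _           = β
  Xᵛ (link _ _)  (trunk _ _) = β
  Xᵛ (link _ _)  _           = τ
  Xᵛ (item _ _)  _           = τ
  Xᵛ _           _           = 1ℚ

  open Encoded V-finite edge? using (module Solution)
  open Solution root Yᵛ Xᵛ using (ϕ; cut; assignment; feasible) public

  β≤1 : β ≤ 1ℚ
  β≤1 = ≤-trans (p≤p+q 0≤τ) β+τ≤1

  τ≤1 : τ ≤ 1ℚ
  τ≤1 = ≤-trans (p≤q+p 0≤β) β+τ≤1

  Unit : ℚ → Set
  Unit q = 0ℚ ≤ q × q ≤ 1ℚ

  Y-unit : ∀ v → Unit (Yᵛ v)
  Y-unit root         = 0≤1 , ≤-refl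
  Y-unit hub          = 0≤1 , ≤-refl
  Y-unit origin       = 0≤1 , ≤-refl
  Y-unit (spine _)    = 0≤1 , ≤-refl
  Y-unit (trunk₀ _)   = 0≤β , β≤1
  Y-unit (trunk _ _)  = 0≤β , β≤1
  Y-unit (link _ _)   = +-nonneg 0≤β 0≤τ , β+τ≤1
  Y-unit (item _ _)   = 0≤1 , ≤-refl
  Y-unit (tail _ _ _) = 0≤1 , ≤-refl

  X-unit : ∀ t h → Unit (Xᵛ t h)
  X-unit root         _            = 0≤1 , ≤-refl
  X-unit hub          _            = 0≤1 , ≤-refl
  X-unit origin       _            = 0≤1 , ≤-refl
  X-unit (spine _)    _            = 0≤1 , ≤-refl
  X-unit (trunk₀ _)   _            = 0≤β , β≤1
  X-unit (trunk _ _)  _            = 0≤β , β≤1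
  X-unit (link _ _)   root         = 0≤τ , τ≤1
  X-unit (link _ _)   hub          = 0≤τ , τ≤1
  X-unit (link _ _)   origin       = 0≤τ , τ≤1
  X-unit (link _ _)   (spine _)    = 0≤τ , τ≤1
  X-unit (link _ _)   (trunk₀ _)   = 0≤τ , τ≤1
  X-unit (link _ _)   (trunk _ _)  = 0≤β , β≤1
  X-unit (link _ _)   (link _ _)   = 0≤τ , τ≤1
  X-unit (link _ _)   (item _ _)   = 0≤τ , τ≤1
  X-unit (link _ _)   (tail _ _ _) = 0≤τ , τ≤1
  X-unit (item _ _)   _            = 0≤τ , τ≤1
  X-unit (tail _ _ _) _            = 0≤1 , ≤-refl

  X-link↑ : ∀ g i → Xᵛ (link g i) (spineBefore g) ≡ τ
  X-link↑ g i = prev-elim (λ v → Xᵛ (link g i) v ≡ τ) refl (λ _ → refl) g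

  ϕ-nonneg : ∀ t h → 0ℚ ≤ ϕ t h
  ϕ-nonneg t h = only-if-nonneg (does (edge? t h)) (proj₁ (X-unit t h))

  ϕ≤X : ∀ t h → ϕ t h ≤ Xᵛ t h
  ϕ≤X t h = only-if-≤ (does (edge? t h)) (proj₁ (X-unit t h))

  ϕ-on : ∀ {t h} → Edge t h → ϕ t h ≡ Xᵛ t h
  ϕ-on {t} {h} e = cong (λ b → only-if b (Xᵛ t h)) (dec-true (edge? t h) e)

  ϕ-off : ∀ {t h} → ¬ Edge t h → ϕ t h ≡ 0ℚ
  ϕ-off {t} {h} ¬e = cong (λ b → only-if b (Xᵛ t h)) (dec-false (edge? t h) ¬e)

  -- Contrapositive of `into`: an arc from `t` to `h` would be among those listed for the kind of
  -- `h` and so would give `P`.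
  unreachable : ∀ t {h c} {P : Set} → kind h ≡ c → (Into h c t → P) → ¬ P → ϕ t h ≡ 0ℚ
  unreachable t refl f ¬p = ϕ-off (¬p ∘ f ∘ into {t})

  -- Out-degree constraints of the fractional solution.

  link-head-injective : ∀ g i → Injective _≡_ _≡_ (head (link g i))
  link-head-injective g i {zero}     {zero}     _  = refl
  link-head-injective g i {zero}     {suc zero} eq =
    contradiction eq (prev-elim (trunk g i ≢_) (λ ()) (λ _ ()) g)
  link-head-injective g i {suc zero} {zero}     eq =
    contradiction (sym eq) (prev-elim (trunk g i ≢_) (λ ()) (λ _ ()) g)
  link-head-injective g i {suc zero} {suc zero} _  = refl

  one-head : {v : V} → Injective _≡_ _≡_ (λ (_ : Fin 1) → v)
  one-head {_} {zero} {zero} _ = refl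

  head-injective : ∀ v → Injective _≡_ _≡_ (head v)
  head-injective root         {()}
  head-injective hub          = one-head
  head-injective origin       = one-head
  head-injective (spine g)    = one-head
  head-injective (trunk₀ g)   = one-head
  head-injective (trunk g i)  = one-head
  head-injective (link g i)   = link-head-injective g i
  head-injective (item g j)   = λ { refl → refl }
  head-injective (tail g j l) = one-head

  -- Two inequalities: the heads exhaust the arcs out of `v`, and no head is listed twice.
  ϕ-out : ∀ v → ∑[ V-finite ] (ϕ v) ≡ ∑ λ i → Xᵛ v (head v i)
  ϕ-out v = trans
    (≤-antisym
      (∑[]-cover-≤ (finFinite _) V-finite (head v) (ϕ v) (ϕ-nonneg v) cover)
      (∑[]-injective-≤ (finFinite _) V-finite (head v) (ϕ v) (ϕ-nonneg v) (head-injective v)))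
    (∑-cong λ i → ϕ-on {v} {head v i} (i , refl))
    where
    cover : ∀ h → ϕ v h ≡ 0ℚ ⊎ Edge v h
    cover h with edge? v h
    ... | yes e = inj₂ e
    ... | no ¬e = inj₁ refl

  out≡Y : ∀ v → v ≢ root → ∑ (λ i → Xᵛ v (head v i)) ≡ Yᵛ v
  out≡Y root         v≢r = contradiction refl v≢r
  out≡Y hub          _   = refl
  out≡Y origin       _   = refl
  out≡Y (spine g)    _   = refl
  out≡Y (trunk₀ g)   _   = +-identityʳ β
  out≡Y (trunk g i)  _   = +-identityʳ β
  out≡Y (link g i)   _   = cong (β +_) (trans (+-identityʳ _) (X-link↑ g i))
  out≡Y (item g j)   _   = ∑τ≡1
  out≡Y (tail g j l) _   = refl

  -- In-degree constraints of the fractional solution.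

  ϕ-in : ∀ {I : Set} (F : Finite I) (e : I → V) {h} → (∀ {t} → Into h (kind h) t → ∃[ i ] e i ≡ t) →
         ∑[ V-finite ] (λ t → ϕ t h) ≤ ∑[ F ] (λ i → ϕ (e i) h)
  ϕ-in F e {h} covered = ∑[]-cover-≤ F V-finite e (λ t → ϕ t h) (λ t → ϕ-nonneg t h) cover
    where
    cover : ∀ t → ϕ t h ≡ 0ℚ ⊎ (∃[ i ] e i ≡ t)
    cover t with edge? t h
    ... | yes ed = inj₂ (covered (into ed))
    ... | no _   = inj₁ refl

  -- Injectivity of `spineBefore` leaves one group. Its spine vertex brings at most one unit, and
  -- its `W` links together bring at most another.
  in-spine : ∀ h → kind h ≡ spineᵏ → ∑[ V-finite ] (λ t → ϕ t h) ≤ 2ℚ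
  in-spine h is = ≤-trans
    (ϕ-in (finFinite k ⊎-finite (finFinite k ×-finite finFinite W)) e (cov ∘ subst (λ c → Into h c _) is))
    (≤-trans (≤-reflexive (separate λ i → ϕ (e i) h))
      (+-mono-≤
        (∑-at-most-one (finFinite k) 0≤1 (λ g → ϕ-nonneg (spine g) h) (λ g → ϕ≤X (spine g) h)
          (λ g → spineBefore g ≟ h) (λ {g} → unreachable (spine g) is into-spine) same)
        (∑-at-most-one (finFinite k) 0≤1 (λ g → ∑-nonneg λ i → ϕ-nonneg (link g i) h)
          links≤1 (λ g → spineBefore g ≟ h)
          (λ {g} ¬p → trans (∑-cong λ i → unreachable (link g i) is into-link ¬p) (∑-zero W)) same)))
    where
    separate : ∀ f → ∑[ finFinite k ⊎-finite (finFinite k ×-finite finFinite W) ] f ≡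
                     ∑ (f ∘ inj₁) + ∑ λ g → ∑ λ i → f (inj₂ (g , i))
    separate f = trans (∑-⊎ (finFinite k) (finFinite k ×-finite finFinite W) f)
      (cong (∑ (f ∘ inj₁) +_) (∑-× (finFinite k) (finFinite W) (f ∘ inj₂)))
    e : Fin k ⊎ (Fin k × Fin W) → V
    e (inj₁ g)       = spine g
    e (inj₂ (g , i)) = link g i
    cov : ∀ {t} → Into h spineᵏ t → ∃[ i ] e i ≡ t
    cov (via-spine g _)   = inj₁ g , refl
    cov (via-link↑ g i _) = inj₂ (g , i) , refl
    into-spine : ∀ {g} → Into h spineᵏ (spine g) → spineBefore g ≡ h
    into-spine (via-spine _ eq) = eq
    into-link : ∀ {g i} → Into h spineᵏ (link g i) → spineBefore g ≡ h
    into-link (via-link↑ _ _ eq) = eq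
    same : ∀ {g g′} → spineBefore g ≡ h → spineBefore g′ ≡ h → g ≡ g′
    same p q = spineBefore-injective (trans p (sym q))
    X-spine : ∀ v {g i} → kind v ≡ spineᵏ → Xᵛ (link g i) v ≡ τ
    X-spine origin    _ = refl
    X-spine (spine _) _ = refl
    X-spine (trunk₀ _)   ()
    X-spine (trunk _ _)  ()
    X-spine (link _ _)   ()
    X-spine (item _ _)   ()
    X-spine (tail _ _ _) ()
    links≤1 : ∀ g → ∑ (λ i → ϕ (link g i) h) ≤ 1ℚ
    links≤1 g = ≤-trans (∑-mono λ i → ≤-trans (ϕ≤X (link g i) h) (≤-reflexive (X-spine h is)))
      (≤-reflexive ∑τ≡1)

  -- One `β` can come from the next trunk vertex and one from the link attached at `h`; no further
  -- arcs enter.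
  in-trunk : ∀ h → kind h ≡ trunkᵏ → ∑[ V-finite ] (λ t → ϕ t h) ≤ 2ℚ * β
  in-trunk h is = ≤-trans
    (ϕ-in (GW ⊎-finite GW) e (cov ∘ subst (λ c → Into h c _) is))
    (≤-trans (≤-reflexive (∑-⊎ GW GW λ i → ϕ (e i) h))
      (≤-trans (+-mono-≤
        (∑-at-most-one GW 0≤β (λ (g , i) → ϕ-nonneg (trunk g i) h) (λ (g , i) → ϕ≤X (trunk g i) h)
          (λ (g , i) → trunkBefore g i ≟ h) (λ {(g , i)} → unreachable (trunk g i) is into-trunk)
          (λ p q → trunkBefore-injective (trans p (sym q))))
        (∑-at-most-one GW 0≤β (λ (g , i) → ϕ-nonneg (link g i) h) link≤β
          (λ (g , i) → trunk g i ≟ h) (λ {(g , i)} → unreachable (link g i) is into-link)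
          (λ { refl refl → refl })))
        (≤-reflexive (sym (2*p≡p+p β)))))
    where
    GW = finFinite k ×-finite finFinite W
    e : (Fin k × Fin W) ⊎ (Fin k × Fin W) → V
    e (inj₁ (g , i)) = trunk g i
    e (inj₂ (g , i)) = link g i
    cov : ∀ {t} → Into h trunkᵏ t → ∃[ i ] e i ≡ t
    cov (via-trunk g i _) = inj₁ (g , i) , refl
    cov (via-link g i _)  = inj₂ (g , i) , refl
    into-trunk : ∀ {g i} → Into h trunkᵏ (trunk g i) → trunkBefore g i ≡ h
    into-trunk (via-trunk _ _ eq) = eq
    into-link : ∀ {g i} → Into h trunkᵏ (link g i) → trunk g i ≡ h
    into-link (via-link _ _ eq) = eq
    link≤β : ∀ ((g , i) : Fin k × Fin W) → ϕ (link g i) h ≤ β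
    -- At `trunk₀` the entry of `Xᵛ` is `τ`, which is not assumed to be at most `β`; pairs that are
    -- not arcs are therefore treated apart.
    link≤β (g , i) with trunk g i ≟ h
    ... | yes refl = ϕ≤X (link g i) (trunk g i)
    ... | no ¬p    = ≤-trans (≤-reflexive (unreachable (link g i) is into-link ¬p)) 0≤β

  in-item : ∀ h → kind h ≡ itemᵏ → ∑[ V-finite ] (λ t → ϕ t h) ≤ 1ℚ
  in-item h is = ≤-trans
    (ϕ-in F e (cov ∘ subst (λ c → Into h c _) is))
    (∑-at-most-one F 0≤1 (λ (g , j , l) → ϕ-nonneg (tail g j l) h) (λ (g , j , l) → ϕ≤X (tail g j l) h)
      (λ (g , j , l) → tailBefore g j l ≟ h) (λ {(g , j , l)} → unreachable (tail g j l) is into-tail)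
      (λ p q → tailBefore-injective (trans p (sym q))))
    where
    F = finFinite k ×-finite (finFinite K ×-finite finFinite ℓ)
    e : Fin k × (Fin K × Fin ℓ) → V
    e (g , j , l) = tail g j l
    cov : ∀ {t} → Into h itemᵏ t → ∃[ i ] e i ≡ t
    cov (via-tail g j l _) = (g , j , l) , refl
    into-tail : ∀ {g j l} → Into h itemᵏ (tail g j l) → tailBefore g j l ≡ h
    into-tail (via-tail _ _ _ eq) = eq

  in≤ : ∀ h → ∑[ V-finite ] (λ t → ϕ t h) ≤ 2ℚ * Yᵛ h
  in≤ root = ≤-trans (ϕ-in (finFinite 2) e λ { via-hub → zero , refl ; via-origin → suc zero , refl })
    (∑-mono λ i → ≤-trans (ϕ≤X (e i) root) (proj₂ (X-unit (e i) root)))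
    where
    e : Fin 2 → V
    e zero    = hub
    e (suc _) = origin
  in≤ hub = ≤-trans (ϕ-in (finFinite k) (λ g → trunk₀ g) λ { (via-trunk₀ g) → g , refl })
    (≤-trans (∑-mono λ g → ϕ≤X (trunk₀ g) hub) (≤-reflexive ∑β≡2))
  in≤ origin         = in-spine origin refl
  in≤ h@(spine _)    = in-spine h refl
  in≤ h@(trunk₀ _)   = in-trunk h refl
  in≤ h@(trunk _ _)  = in-trunk h refl
  in≤ (link g i) = ≤-trans (ϕ-in (finFinite K) (λ j → item g j) λ { (via-item _ j _ refl) → j , refl })
    (≤-trans (∑-mono λ j → ϕ≤X (item g j) (link g i)) ∑τ≤)
  in≤ h@(item _ _)   = ≤-trans (in-item h refl) (p≤p+q 0≤1)
  in≤ h@(tail _ _ _) = ≤-trans (in-item h refl) (p≤p+q 0≤1)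

  -- Cut constraints of the fractional solution.

  module Cuts (s : V → Bool) (root∉s : s root ≡ false) where

    Exit : V × V → Set
    Exit (t , h) = s t ≡ true × s h ≡ false × Edge t h

    crossing : V × V → ℚ
    crossing (t , h) = only-if (s t ∧ not (s h)) (ϕ t h)

    -- Distinct pairs are distinct terms of the double sum `cut s`, and the terms left out are
    -- nonnegative.
    exits≤cut : ∀ {n} (e : Fin n → V × V) → Injective _≡_ _≡_ e → (∀ i → Exit (e i)) →
                ∑ (λ i → Xᵛ (proj₁ (e i)) (proj₂ (e i))) ≤ cut s
    exits≤cut e inj exit = begin
      ∑ (λ i → Xᵛ (proj₁ (e i)) (proj₂ (e i)))  ≡⟨ ∑-cong (λ i → on (exit i)) ⟨
      ∑ (crossing ∘ e)                          ≤⟨ ∑[]-injective-≤ (finFinite _) (V-finite ×-finite V-finite)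
                                                     e crossing nonneg inj ⟩
      ∑[ V-finite ×-finite V-finite ] crossing  ≡⟨ ∑-× V-finite V-finite crossing ⟩
      cut s                                     ∎
      where
      open ≤-Reasoning
      nonneg : ∀ p → 0ℚ ≤ crossing p
      nonneg (t , h) = only-if-nonneg (s t ∧ not (s h)) (ϕ-nonneg t h)
      on : ∀ {p} → Exit p → crossing p ≡ Xᵛ (proj₁ p) (proj₂ p)
      on (t∈s , h∉s , ed) rewrite t∈s | h∉s = ϕ-on ed

    exit≤cut : ∀ {t h} → Exit (t , h) → Xᵛ t h ≤ cut s
    exit≤cut exit = ≤-trans (≤-reflexive (sym (+-identityʳ _)))
      (exits≤cut (λ (_ : Fin 1) → _) (λ { {zero} {zero} _ → refl }) (λ _ → exit))

    Full : V → Set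
    Full v = s v ≡ true → 1ℚ ≤ cut s

    -- Either the head lies in `s` and the unit is found further on, or this arc of weight one
    -- itself leaves `s`.
    full-step : ∀ {t h} → Edge t h → Xᵛ t h ≡ 1ℚ → Full h → Full t
    full-step {t} {h} ed X≡1 full t∈s with s h in eq
    ... | true  = full refl
    ... | false = subst (_≤ cut s) X≡1 (exit≤cut (t∈s , eq , ed))

    full-root : Full root
    full-root r∈s = contradiction (trans (sym root∉s) r∈s) λ ()

    full-hub : Full hub
    full-hub = full-step (zero , refl) refl full-root

    full-origin : Full origin
    full-origin = full-step (zero , refl) refl full-root

    full-spine : ∀ g → Full (spine g)
    full-spine = chain-induction Full full-origin λ g → full-step (zero , refl) refl

    full-spineBefore : ∀ g → Full (spineBefore g)
    full-spineBefore = prev-elim Full full-origin full-spine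

    -- The tail is recorded not to be a link. This keeps the arc apart from a link's arc into the
    -- spine, so that `link-cut` may count both.
    TrunkExit : Set
    TrunkExit = ∃[ t ] ∃[ h ] Exit (t , h) × Xᵛ t h ≡ β × (∀ {g i} → t ≢ link g i)

    Trunk : V → Set
    Trunk v = s v ≡ true → 1ℚ ≤ cut s ⊎ TrunkExit

    trunk-step : ∀ {t h} → Edge t h → Xᵛ t h ≡ β → (∀ {g i} → t ≢ link g i) → Trunk h → Trunk t
    trunk-step {t} {h} ed X≡β t≢link rest t∈s with s h in eq
    ... | true  = rest refl
    ... | false = inj₂ (t , h , (t∈s , eq , ed) , X≡β , t≢link)

    trunk₀-exit : ∀ g → Trunk (trunk₀ g)
    trunk₀-exit g = trunk-step (zero , refl) refl (λ ()) (inj₁ ∘ full-hub)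

    trunk-exit : ∀ g i → Trunk (trunk g i)
    trunk-exit g = chain-induction Trunk (trunk₀-exit g) λ i → trunk-step (zero , refl) refl (λ ())

    trunk-cut : ∀ {v} → Trunk v → s v ≡ true → β ≤ cut s
    trunk-cut exits v∈s with exits v∈s
    ... | inj₁ 1≤cut                  = ≤-trans β≤1 1≤cut
    ... | inj₂ (_ , _ , exit , X≡β , _) = subst (_≤ cut s) X≡β (exit≤cut exit)

    two-exits : ∀ {p q} → p ≢ q → Exit p → Exit q →
                Xᵛ (proj₁ p) (proj₂ p) + Xᵛ (proj₁ q) (proj₂ q) ≤ cut s
    two-exits {p} {q} p≢q ep eq = ≤-trans (≤-reflexive (cong (Xᵛ (proj₁ p) (proj₂ p) +_) (sym (+-identityʳ _))))
      (exits≤cut e inj λ { zero → ep ; (suc zero) → eq })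
      where
      e : Fin 2 → V × V
      e zero    = p
      e (suc _) = q
      inj : Injective _≡_ _≡_ e
      inj {zero}     {zero}     _  = refl
      inj {zero}     {suc zero} eq = contradiction eq p≢q
      inj {suc zero} {zero}     eq = contradiction (sym eq) p≢q
      inj {suc zero} {suc zero} _  = refl

    -- If the spine end lies in `s`, the spine alone yields a unit. Otherwise the arc into the spine
    -- leaves with `τ`, and a further `β` leaves on the arc to the trunk or further along it, unless
    -- the hub is reached and yields a full unit.
    link-cut : ∀ g i → s (link g i) ≡ true → β + τ ≤ cut s
    link-cut g i l∈s with s (spineBefore g) in up
    ... | true  = ≤-trans β+τ≤1 (full-spineBefore g up)
    ... | false with s (trunk g i) in across
    ...   | false = subst (λ x → β + x ≤ cut s) (X-link↑ g i)
      (two-exits (λ eq → prev-elim (trunk g i ≢_) (λ ()) (λ _ ()) g (cong proj₂ eq))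
        (l∈s , across , zero , refl) (l∈s , up , suc zero , refl))
    ...   | true with trunk-exit g i across
    ...     | inj₁ 1≤cut = ≤-trans β+τ≤1 1≤cut
    ...     | inj₂ (t , h , exit , X≡β , t≢link) = subst₂ (λ x y → x + y ≤ cut s) X≡β (X-link↑ g i)
      (two-exits (λ eq → t≢link (cong proj₁ eq)) exit (l∈s , up , suc zero , refl))

    -- The paths from the item over its links to the spine are arc-disjoint, and all their arcs have
    -- weight `τ`. If the spine end is outside `s`, each of the `W` paths has an arc leaving `s`:
    -- the second if the link is inside, else the first.
    full-item : ∀ g j → Full (item g j)
    full-item g j z∈s with s (spineBefore g) in up
    ... | true  = full-spineBefore g up
    ... | false = subst (_≤ cut s) (trans (∑-cong weight) ∑τ≡1) (exits≤cut e inj exit)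
      where
      choose : Bool → Fin W → V × V
      choose true  i = link g i , spineBefore g
      choose false i = item g j , link g i
      e : Fin W → V × V
      e i = choose (s (link g i)) i
      exit : ∀ i → Exit (e i)
      exit i with s (link g i) in eq
      ... | true  = eq , up , suc zero , refl
      ... | false = z∈s , eq , i , refl
      weight : ∀ i → Xᵛ (proj₁ (e i)) (proj₂ (e i)) ≡ τ
      weight i with s (link g i)
      ... | true  = X-link↑ g i
      ... | false = refl
      choose-injective : ∀ b b′ {i i′} → choose b i ≡ choose b′ i′ → i ≡ i′
      choose-injective true  true  eq with cong proj₁ eq
      ... | refl = refl
      choose-injective false false refl = refl
      choose-injective true  false eq with cong proj₁ eq
      ... | ()
      choose-injective false true  eq with cong proj₁ eq
      ... | ()
      inj : Injective _≡_ _≡_ e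
      inj {i} {i′} = choose-injective (s (link g i)) (s (link g i′))

    full-tail : ∀ g j l → Full (tail g j l)
    full-tail g j = chain-induction Full (full-item g j) λ l → full-step (zero , refl) refl

    connected : ∀ v → s v ≡ true → Yᵛ v ≤ cut s
    connected root         = full-root
    connected hub          = full-hub
    connected origin       = full-origin
    connected (spine g)    = full-spine g
    connected (trunk₀ g)   = trunk-cut (trunk₀-exit g)
    connected (trunk g i)  = trunk-cut (trunk-exit g i)
    connected (link g i)   = link-cut g i
    connected (item g j)   = full-item g j
    connected (tail g j l) = full-tail g j l

  solution-feasible : LPFeasible graph (from root) assignment
  solution-feasible = feasible in≤ (λ v v≢root → trans (ϕ-out v) (out≡Y v v≢root))
    (λ s root∉s → Cuts.connected s root∉s) Y-unit X-unit

-- Integers in ℚ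

-- `z / 1` is reduced by a gcd that does not compute for a variable `z`; facts about integers in ℚ
-- are therefore derived from unnormalised fractions.
toℚᵘ-/1 : ∀ z → toℚᵘ (z / 1) ℚᵘ.≃ ℚᵘ.mkℚᵘ z 0
toℚᵘ-/1 z = toℚᵘ-fromℚᵘ (ℚᵘ.mkℚᵘ z 0)

/1-cancel-≤ : ∀ {z w} → z / 1 ≤ w / 1 → z ℤ.≤ w
/1-cancel-≤ {z} {w} le = subst₂ ℤ._≤_ (ℤ.*-identityʳ z) (ℤ.*-identityʳ w)
  (ℚᵘ.drop-*≤* (ℚᵘ.≤-respʳ-≃ (toℚᵘ-/1 w) (ℚᵘ.≤-respˡ-≃ (toℚᵘ-/1 z) (toℚᵘ-mono-≤ le))))

ι : ℕ → ℚ
ι n = ℤ.+ n / 1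

ι-mono-≤ : ∀ {m n} → m ℕ.≤ n → ι m ≤ ι n
ι-mono-≤ {m} {n} m≤n = toℚᵘ-cancel-≤
  (ℚᵘ.≤-respʳ-≃ (ℚᵘ.≃-sym (toℚᵘ-/1 (ℤ.+ n))) (ℚᵘ.≤-respˡ-≃ (ℚᵘ.≃-sym (toℚᵘ-/1 (ℤ.+ m)))
    (ℚᵘ.*≤* (ℤ.*-monoʳ-≤-nonNeg (ℤ.+ 1) (ℤ.+≤+ m≤n)))))

ι-nonneg : ∀ n → 0ℚ ≤ ι n
ι-nonneg n = ι-mono-≤ {0} {n} ℕ.z≤n

ι-+ : ∀ m n → ι (m ℕ.+ n) ≡ ι m + ι n
ι-+ m n = toℚᵘ-injective (ℚᵘ.≃-trans (toℚᵘ-/1 (ℤ.+ (m ℕ.+ n))) (ℚᵘ.≃-sym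
  (ℚᵘ.≃-trans (toℚᵘ-homo-+ (ι m) (ι n)) (ℚᵘ.≃-trans (ℚᵘ.+-cong (toℚᵘ-/1 (ℤ.+ m)) (toℚᵘ-/1 (ℤ.+ n)))
    (ℚᵘ.*≡* (cong (ℤ._* ℤ.+ 1) (cong₂ ℤ._+_ (ℤ.*-identityʳ (ℤ.+ m)) (ℤ.*-identityʳ (ℤ.+ n)))))))))

ι-* : ∀ m n → ι (m ℕ.* n) ≡ ι m * ι n
ι-* m n = toℚᵘ-injective (ℚᵘ.≃-trans (toℚᵘ-/1 (ℤ.+ (m ℕ.* n))) (ℚᵘ.≃-sym
  (ℚᵘ.≃-trans (toℚᵘ-homo-* (ι m) (ι n)) (ℚᵘ.≃-trans (ℚᵘ.*-cong (toℚᵘ-/1 (ℤ.+ m)) (toℚᵘ-/1 (ℤ.+ n)))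
    (ℚᵘ.*≡* (cong (ℤ._* ℤ.+ 1) (sym (ℤ.pos-* m n))))))))

integer-unit : ∀ {q} → IsInteger q → 0ℚ ≤ q → q ≤ 1ℚ → q ≡ 0ℚ ⊎ q ≡ 1ℚ
integer-unit (z , refl) 0≤q q≤1 with z | /1-cancel-≤ {ℤ.+ 0} {z} 0≤q | /1-cancel-≤ {z} {ℤ.+ 1} q≤1
... | ℤ.+ 0             | _ | _                      = inj₁ refl
... | ℤ.+ 1             | _ | _                      = inj₂ refl
... | ℤ.+ suc (suc _)   | _ | ℤ.+≤+ (ℕ.s≤s ())
... | ℤ.-[1+ _ ]        | () | _

∑-const : ∀ n c → ∑ {n} (λ _ → c) ≡ ι n * c
∑-const zero    c = sym (*-zeroˡ c)
∑-const (suc n) c = begin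
  c + ∑ {n} (λ _ → c)     ≡⟨ cong₂ _+_ (sym (*-identityˡ c)) (∑-const n c) ⟩
  1ℚ * c + ι n * c        ≡⟨ *-distribʳ-+ c 1ℚ (ι n) ⟨
  (1ℚ + ι n) * c          ≡⟨ cong (_* c) (ι-+ 1 n) ⟨
  ι (suc n) * c           ∎
  where open ≡-Reasoning

∑-*ˡ : ∀ {n} c (f : Fin n → ℚ) → ∑ (λ i → c * f i) ≡ c * ∑ f
∑-*ˡ c f = sym (∑ₛ.*-distribˡ-sum c f)

∑-+ : ∀ {n} (f g : Fin n → ℚ) → ∑ (λ i → f i + g i) ≡ ∑ f + ∑ g
∑-+ = ∑ₚ.∑-distrib-+

-- Bounds on both optima

module GadgetValue (k W K ℓ : ℕ) where

  open Gadget k W K ℓ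
  open Finite V-finite using (from)

  groupTotal : (V → ℚ) → Fin k → ℚ
  groupTotal f g = f (spine g) + (f (trunk₀ g) + (∑ (λ i → f (trunk g i)) + (∑ (λ i → f (link g i)) +
    (∑ (λ j → f (item g j)) + ∑ λ j → ∑ λ l → f (tail g j l)))))

  ∑-V : ∀ f → ∑[ V-finite ] f ≡ f root + (f hub + f origin) + ∑ (groupTotal f)
  ∑-V f = trans (∑-⊎ ends (finFinite k ×-finite Group-finite) f) (cong₂ _+_
    (trans (∑-⊎ ⊤-finite (⊤-finite ⊎-finite ⊤-finite) (f ∘ inj₁)) (cong₂ _+_ (∑-⊤ λ _ → f root)
      (trans (∑-⊎ ⊤-finite ⊤-finite λ x → f (inj₁ (inj₂ x))) (cong₂ _+_ (∑-⊤ λ _ → f hub) (∑-⊤ λ _ → f origin)))))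
    (trans (∑-× (finFinite k) Group-finite (f ∘ inj₂)) (∑-cong λ g → within (λ x → f (inj₂ (g , x))))))
    where
    ends = ⊤-finite ⊎-finite (⊤-finite ⊎-finite ⊤-finite)
    KL = finFinite K ×-finite finFinite ℓ
    within : ∀ (f : Group → ℚ) → ∑[ Group-finite ] f ≡ f (inj₁ tt) + (f (inj₂ (inj₁ tt)) +
      (∑ (λ i → f (inj₂ (inj₂ (inj₁ i)))) + (∑ (λ i → f (inj₂ (inj₂ (inj₂ (inj₁ i))))) +
      (∑ (λ j → f (inj₂ (inj₂ (inj₂ (inj₂ (inj₁ j)))))) +
        ∑ λ j → ∑ λ l → f (inj₂ (inj₂ (inj₂ (inj₂ (inj₂ (j , l))))))))))
    within f =
      trans (∑-⊎ ⊤-finite (⊤-finite ⊎-finite (finFinite W ⊎-finite (finFinite W ⊎-finite (finFinite K ⊎-finite KL)))) f)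
        (cong₂ _+_ (∑-⊤ λ _ → f (inj₁ tt))
      (trans (∑-⊎ ⊤-finite (finFinite W ⊎-finite (finFinite W ⊎-finite (finFinite K ⊎-finite KL))) (f ∘ inj₂))
        (cong₂ _+_ (∑-⊤ λ _ → f (inj₂ (inj₁ tt)))
      (trans (∑-⊎ (finFinite W) (finFinite W ⊎-finite (finFinite K ⊎-finite KL)) (λ x → f (inj₂ (inj₂ x))))
        (cong (∑ (λ i → f (inj₂ (inj₂ (inj₁ i)))) +_)
      (trans (∑-⊎ (finFinite W) (finFinite K ⊎-finite KL) (λ x → f (inj₂ (inj₂ (inj₂ x)))))
        (cong (∑ (λ i → f (inj₂ (inj₂ (inj₂ (inj₁ i))))) +_)
      (trans (∑-⊎ (finFinite K) KL (λ x → f (inj₂ (inj₂ (inj₂ (inj₂ x))))))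
        (cong (∑ (λ j → f (inj₂ (inj₂ (inj₂ (inj₂ (inj₁ j)))))) +_)
          (∑-× (finFinite K) (finFinite ℓ) (λ x → f (inj₂ (inj₂ (inj₂ (inj₂ (inj₂ x))))))))))))))))

  -- How often `y (trunk₀ g)` is charged in its group: once for itself, `W` times for the other
  -- trunk vertices, and `W` times for what the links send to the trunk.
  trunkWeight : ℚ
  trunkWeight = 1ℚ + 2ℚ * ι W

  itemWeight : ℚ
  itemWeight = 1ℚ + ι ℓ

  -- The contribution outside items and tails: three for the root, the hub and the origin, two per
  -- group for the spine vertex and the link flow into the spine, and `trunkWeight` for each of the
  -- two trunks the hub admits.
  base : ℚ
  base = ι 3 + (ι k * 2ℚ + trunkWeight * 2ℚ)

  0≤trunkWeight : 0ℚ ≤ trunkWeight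
  0≤trunkWeight = +-nonneg 0≤1 (*-nonneg {2ℚ} (ι-nonneg 2) (ι-nonneg W))

  0≤itemWeight : 0ℚ ≤ itemWeight
  0≤itemWeight = +-nonneg 0≤1 (ι-nonneg ℓ)

  -- Serves both the bound for an arbitrary feasible point and the value of the fractional solution,
  -- so that the two end in the same formula.
  ∑-groups : ∀ (b z : Fin k → ℚ) →
    ι 3 + ∑ (λ g → 2ℚ + (trunkWeight * b g + itemWeight * z g)) ≡
    ι 3 + (ι k * 2ℚ + trunkWeight * ∑ b) + itemWeight * ∑ z
  ∑-groups b z = begin
    ι 3 + ∑ (λ g → 2ℚ + (trunkWeight * b g + itemWeight * z g))
      ≡⟨ cong (ι 3 +_) (∑-+ (λ _ → 2ℚ) (λ g → trunkWeight * b g + itemWeight * z g)) ⟩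
    ι 3 + (∑ {k} (λ _ → 2ℚ) + ∑ (λ g → trunkWeight * b g + itemWeight * z g))
      ≡⟨ cong (ι 3 +_) (cong₂ _+_ (∑-const k 2ℚ)
           (trans (∑-+ (λ g → trunkWeight * b g) (λ g → itemWeight * z g)) (cong₂ _+_ (∑-*ˡ trunkWeight b) (∑-*ˡ itemWeight z)))) ⟩
    ι 3 + (ι k * 2ℚ + (trunkWeight * ∑ b + itemWeight * ∑ z))
      ≡⟨ cong (ι 3 +_) (+-assoc (ι k * 2ℚ) (trunkWeight * ∑ b) (itemWeight * ∑ z)) ⟨
    ι 3 + ((ι k * 2ℚ + trunkWeight * ∑ b) + itemWeight * ∑ z)
      ≡⟨ +-assoc (ι 3) (ι k * 2ℚ + trunkWeight * ∑ b) (itemWeight * ∑ z) ⟨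
    ι 3 + (ι k * 2ℚ + trunkWeight * ∑ b) + itemWeight * ∑ z ∎
    where open ≡-Reasoning

  -- Inequalities valid at every feasible point.

  module AnyFeasible {a : Assignment (Finite.size V-finite)} (lp : LPFeasible graph (from root) a) where

    open Encoded.Bounds V-finite edge? {root} {a} lp public

    y≤out : ∀ v → v ≢ root → y v ≤ ∑ λ i → ϕ v (head v i)
    y≤out v v≢root = ≤-trans (≤-reflexive (sym (ϕ-out v≢root)))
      (∑[]-cover-≤ (finFinite _) V-finite (head v) (ϕ v) (ϕ-nonneg v) cover)
      where
      cover : ∀ h → ϕ v h ≡ 0ℚ ⊎ Edge v h
      cover h with edge? v h
      ... | yes e = inj₂ e
      ... | no ¬e = inj₁ (ϕ-off ¬e)

    -- The equation expresses that `h` is the single head of `v`; for concrete kinds of vertices it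
    -- holds by computation.
    y≤next : ∀ v h → v ≢ root → ∑ (λ i → ϕ v (head v i)) ≡ ϕ v h + 0ℚ → y v ≤ ϕ v h
    y≤next v h v≢root eq = ≤-trans (y≤out v v≢root) (≤-reflexive (trans eq (+-identityʳ (ϕ v h))))

    in≤2 : ∀ {I : Set} (F : Finite I) (e : I → V) → Injective _≡_ _≡_ e → ∀ h →
           ∑[ F ] (λ i → ϕ (e i) h) ≤ 2ℚ * y h
    in≤2 F e inj h = ≤-trans (∑[]-injective-≤ F V-finite e (λ t → ϕ t h) (λ t → ϕ-nonneg t h) inj) (ϕ-in h)

    2*y≤2 : ∀ v → 2ℚ * y v ≤ 2ℚ
    2*y≤2 v = ≤-trans (*-monoˡ 2ℚ (ι-nonneg 2) (y≤1 v)) (≤-reflexive (*-identityʳ 2ℚ))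

    trunks : ℚ
    trunks = ∑ λ g → y (trunk₀ g)

    -- Each trunk sends its whole value into the hub, whose in-capacity is at most two.
    trunks≤2 : trunks ≤ 2ℚ
    trunks≤2 = ≤-trans (∑-mono λ g → y≤next (trunk₀ g) hub (λ ()) refl)
      (≤-trans (in≤2 (finFinite k) (λ g → trunk₀ g) (λ { refl → refl }) hub) (2*y≤2 hub))

    -- The in-degree constraint alone would allow the value to double at each step away from the
    -- hub; the cut inequality `ϕ≤y` keeps it from growing.
    trunk≤trunk₀ : ∀ g i → y (trunk g i) ≤ y (trunk₀ g)
    trunk≤trunk₀ g = chain-induction {a = trunk₀ g} (λ v → y v ≤ y (trunk₀ g)) ≤-refl λ i →
      ≤-trans (≤-trans (y≤next (trunk g i) (trunkBefore g i) (λ ()) refl)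
        (ϕ≤y {trunk g i} {trunkBefore g i} (λ ()) (prev-elim (_≢ root) (λ ()) (λ _ ()) i)))

    tail≤item : ∀ g j l → y (tail g j l) ≤ y (item g j)
    tail≤item g j = chain-induction {a = item g j} (λ v → y v ≤ y (item g j)) ≤-refl λ l →
      ≤-trans (≤-trans (y≤next (tail g j l) (tailBefore g j l) (λ ()) refl)
        (ϕ≤y {tail g j l} {tailBefore g j l} (λ ()) (prev-elim (_≢ root) (λ ()) (λ _ ()) l)))

    up : Fin k → Fin W → ℚ
    up g i = ϕ (link g i) (spineBefore g)

    link≤ : ∀ g i → y (link g i) ≤ y (trunk₀ g) + up g i
    link≤ g i = ≤-trans (y≤out (link g i) λ ()) (+-mono-≤
      (≤-trans (ϕ≤y {link g i} {trunk g i} (λ ()) (λ ())) (trunk≤trunk₀ g i)) (≤-reflexive (+-identityʳ (up g i))))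

    -- `spine g` and the links of its group all enter `spineBefore g`, whose in-capacity is at most
    -- two.
    spine+up≤2 : ∀ g → y (spine g) + ∑ (up g) ≤ 2ℚ
    spine+up≤2 g = begin
      y (spine g) + ∑ (up g)                        ≤⟨ +-monoˡ-≤ (∑ (up g)) (y≤next (spine g) (spineBefore g) (λ ()) refl) ⟩
      ϕ (spine g) (spineBefore g) + ∑ (up g)        ≡⟨ cong (_+ ∑ (up g)) (∑-⊤ λ _ → ϕ (spine g) (spineBefore g)) ⟨
      ∑[ ⊤-finite ] (λ _ → ϕ (spine g) (spineBefore g)) + ∑ (up g)
                                                    ≡⟨ ∑-⊎ ⊤-finite (finFinite W) (λ x → ϕ (e x) (spineBefore g)) ⟨
      ∑[ ⊤-finite ⊎-finite finFinite W ] (λ x → ϕ (e x) (spineBefore g))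
                                                    ≤⟨ in≤2 (⊤-finite ⊎-finite finFinite W) e inj (spineBefore g) ⟩
      2ℚ * y (spineBefore g)                        ≤⟨ 2*y≤2 (spineBefore g) ⟩
      2ℚ                                            ∎
      where
      open ≤-Reasoning
      e : ⊤ ⊎ Fin W → V
      e (inj₁ _) = spine g
      e (inj₂ i) = link g i
      inj : Injective _≡_ _≡_ e
      inj {inj₁ _} {inj₁ _} _    = refl
      inj {inj₂ _} {inj₂ _} refl = refl

    items : Fin k → ℚ
    items g = ∑ λ j → y (item g j)

    links : Fin k → ℚ
    links g = ∑ λ i → y (link g i)

    links≤ : ∀ g → links g ≤ ι W * y (trunk₀ g) + ∑ (up g)
    links≤ g = ≤-trans (∑-mono (link≤ g)) (≤-reflexive
      (trans (∑-+ (λ _ → y (trunk₀ g)) (up g)) (cong (_+ ∑ (up g)) (∑-const W (y (trunk₀ g))))))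

    -- Items split their value among the links of their group, and a link takes in at most twice its
    -- own value; the two sums are exchanged.
    items≤links : ∀ g → items g ≤ 2ℚ * links g
    items≤links g = begin
      items g                                       ≤⟨ ∑-mono (λ j → y≤out (item g j) λ ()) ⟩
      ∑ (λ j → ∑ λ i → ϕ (item g j) (link g i))     ≡⟨ ∑ₚ.∑-comm (λ j i → ϕ (item g j) (link g i)) ⟩
      ∑ (λ i → ∑ λ j → ϕ (item g j) (link g i))     ≤⟨ ∑-mono (λ i → in≤2 (finFinite K) (λ j → item g j)
                                                         (λ { refl → refl }) (link g i)) ⟩
      ∑ (λ i → 2ℚ * y (link g i))                   ≡⟨ ∑-*ˡ 2ℚ (λ i → y (link g i)) ⟩
      2ℚ * links g                                  ∎
      where open ≤-Reasoning

    items≤K : ∀ g → items g ≤ ι K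
    items≤K g = ≤-trans (∑-mono λ j → y≤1 (item g j)) (≤-reflexive (trans (∑-const K 1ℚ) (*-identityʳ (ι K))))

    group≤ : ∀ g → groupTotal y g ≤ 2ℚ + (trunkWeight * y (trunk₀ g) + itemWeight * items g)
    group≤ g = begin
      groupTotal y g
        ≤⟨ +-monoʳ-≤ σ (+-monoʳ-≤ b (+-mono-≤ trunks′ (+-mono-≤ (links≤ g) (+-monoʳ-≤ (items g) tails)))) ⟩
      σ + (b + (ι W * b + ((ι W * b + u) + (items g + ι ℓ * items g))))
        ≡⟨ solve 6 (λ σ b w u z l → σ :+ (b :+ (w :* b :+ ((w :* b :+ u) :+ (z :+ l :* z)))) :=
             (σ :+ u) :+ ((con 1ℚ :+ con 2ℚ :* w) :* b :+ (con 1ℚ :+ l) :* z)) refl σ b (ι W) u (items g) (ι ℓ) ⟩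
      -- The regrouping brings the spine vertex together with the link flow, which are bounded
      -- jointly.
      (σ + u) + (trunkWeight * b + itemWeight * items g)
        ≤⟨ +-monoˡ-≤ (trunkWeight * b + itemWeight * items g) (spine+up≤2 g) ⟩
      2ℚ + (trunkWeight * b + itemWeight * items g) ∎
      where
      open ≤-Reasoning
      open +-*-Solver
      σ = y (spine g)
      b = y (trunk₀ g)
      u = ∑ (up g)
      trunks′ : ∑ (λ i → y (trunk g i)) ≤ ι W * b
      trunks′ = ≤-trans (∑-mono (trunk≤trunk₀ g)) (≤-reflexive (∑-const W b))
      tails : ∑ (λ j → ∑ λ l → y (tail g j l)) ≤ ι ℓ * items g
      tails = ≤-trans (∑-mono λ j → ≤-trans (∑-mono (tail≤item g j)) (≤-reflexive (∑-const ℓ (y (item g j)))))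
        (≤-reflexive (∑-*ˡ (ι ℓ) λ j → y (item g j)))

    -- Only the total of the items is left open; both upper bounds follow by estimating it.
    objective≤ : objective a ≤ base + itemWeight * ∑ items
    objective≤ = begin
      objective a                                             ≡⟨ objective≡ ⟩
      ∑[ V-finite ] y                                         ≡⟨ ∑-V y ⟩
      y root + (y hub + y origin) + ∑ (groupTotal y)
        ≤⟨ +-mono-≤ (+-mono-≤ (y≤1 root) (+-mono-≤ (y≤1 hub) (y≤1 origin))) (∑-mono group≤) ⟩
      ι 3 + ∑ (λ g → 2ℚ + (trunkWeight * y (trunk₀ g) + itemWeight * items g))
        ≡⟨ ∑-groups (λ g → y (trunk₀ g)) items ⟩
      ι 3 + (ι k * 2ℚ + trunkWeight * trunks) + itemWeight * ∑ items
        ≤⟨ +-monoˡ-≤ (itemWeight * ∑ items) (+-monoʳ-≤ (ι 3) (+-monoʳ-≤ (ι k * 2ℚ)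
             (*-monoˡ trunkWeight 0≤trunkWeight trunks≤2))) ⟩
      base + itemWeight * ∑ items ∎
      where open ≤-Reasoning

  -- Upper bounds for the linear and the integer program.

  lpValue : ℚ
  lpValue = base + itemWeight * (ι k * ι K)

  lp≤ : ∀ a → LPFeasible graph (from root) a → objective a ≤ lpValue
  lp≤ a feasible = ≤-trans objective≤ (+-monoʳ-≤ base (*-monoˡ itemWeight 0≤itemWeight
    (≤-trans (∑-mono items≤K) (≤-reflexive (∑-const k (ι K))))))
    where open AnyFeasible feasible

  -- Four items for every group, and `K` more for each of the two trunks that the hub admits.
  ipBound : ℚ
  ipBound = base + itemWeight * (ι k * ι 4 + ι K * 2ℚ)

  ip≤ : ∀ a → IPFeasible graph (from root) a → objective a ≤ ipBound
  ip≤ a feasible = ≤-trans objective≤ (+-monoʳ-≤ base (*-monoˡ itemWeight 0≤itemWeight (begin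
    ∑ items                                        ≤⟨ ∑-mono few ⟩
    ∑ (λ g → ι 4 + ι K * y (trunk₀ g))             ≡⟨ ∑-+ (λ _ → ι 4) (λ g → ι K * y (trunk₀ g)) ⟩
    ∑ {k} (λ _ → ι 4) + ∑ (λ g → ι K * y (trunk₀ g))
                                                   ≡⟨ cong₂ _+_ (∑-const k (ι 4)) (∑-*ˡ (ι K) λ g → y (trunk₀ g)) ⟩
    ι k * ι 4 + ι K * trunks                       ≤⟨ +-monoʳ-≤ (ι k * ι 4) (*-monoˡ (ι K) (ι-nonneg K) trunks≤2) ⟩
    ι k * ι 4 + ι K * 2ℚ                           ∎)))
    where
    open ≤-Reasoning
    open IPFeasible feasible
    open AnyFeasible lpFeasible
    -- Only here integrality enters: y (trunk₀ g) is 0 or 1.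
    few : ∀ g → items g ≤ ι 4 + ι K * y (trunk₀ g)
    few g with integer-unit (Y-integral (from (trunk₀ g))) (y-nonneg (trunk₀ g)) (y≤1 (trunk₀ g))
    ... | inj₂ y≡1 = begin
      items g                          ≤⟨ items≤K g ⟩
      ι K                              ≡⟨ *-identityʳ (ι K) ⟨
      ι K * 1ℚ                         ≡⟨ cong (ι K *_) y≡1 ⟨
      ι K * y (trunk₀ g)               ≤⟨ p≤q+p (ι-nonneg 4) ⟩
      ι 4 + ι K * y (trunk₀ g)         ∎
    ... | inj₁ y≡0 = begin
      items g                          ≤⟨ items≤links g ⟩
      2ℚ * links g                     ≤⟨ *-monoˡ 2ℚ (ι-nonneg 2) (links≤ g) ⟩
      2ℚ * (ι W * y (trunk₀ g) + ∑ (up g))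
        ≡⟨ cong (λ b → 2ℚ * (b + ∑ (up g))) (trans (cong (ι W *_) y≡0) (*-zeroʳ (ι W))) ⟩
      2ℚ * (0ℚ + ∑ (up g))             ≤⟨ *-monoˡ 2ℚ (ι-nonneg 2) (+-monoˡ-≤ (∑ (up g)) (y-nonneg (spine g))) ⟩
      2ℚ * (y (spine g) + ∑ (up g))    ≤⟨ *-monoˡ 2ℚ (ι-nonneg 2) (spine+up≤2 g) ⟩
      ι 4                              ≤⟨ p≤p+q (*-nonneg (ι-nonneg K) (y-nonneg (trunk₀ g))) ⟩
      ι 4 + ι K * y (trunk₀ g)         ∎

  module _ (β τ : ℚ) (0≤β : 0ℚ ≤ β) (0≤τ : 0ℚ ≤ τ)
    (β+τ≤1 : β + τ ≤ 1ℚ) (∑β≡2 : ∑ {k} (λ _ → β) ≡ 2ℚ) (∑τ≡1 : ∑ {W} (λ _ → τ) ≡ 1ℚ)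
    (∑τ≤ : ∑ {K} (λ _ → τ) ≤ 2ℚ * (β + τ)) where

    open FractionalSolution k W K ℓ β τ 0≤β 0≤τ β+τ≤1 ∑β≡2 ∑τ≡1 ∑τ≤

    -- The bound `lp≤` is tight: the trunks total two, spine vertex and link flow total two in each
    -- group, and every item has value one.
    solution-value : objective assignment ≡ lpValue
    solution-value = begin
      ∑[ V-finite ] Yᵛ
        ≡⟨ ∑-V Yᵛ ⟩
      ι 3 + ∑ (groupTotal Yᵛ)
        ≡⟨ cong (ι 3 +_) (∑-cong {k} {groupTotal Yᵛ} λ _ → groupValue) ⟩
      ι 3 + ∑ {k} (λ _ → 2ℚ + (trunkWeight * β + itemWeight * ι K))
        ≡⟨ ∑-groups (λ _ → β) (λ _ → ι K) ⟩
      ι 3 + (ι k * 2ℚ + trunkWeight * ∑ {k} (λ _ → β)) + itemWeight * ∑ {k} (λ _ → ι K)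
        ≡⟨ cong₂ (λ b z → ι 3 + (ι k * 2ℚ + trunkWeight * b) + itemWeight * z) ∑β≡2 (∑-const k (ι K)) ⟩
      lpValue ∎
      where
      open ≡-Reasoning
      open +-*-Solver
      groupValue : 1ℚ + (β + (∑ {W} (λ _ → β) + (∑ {W} (λ _ → β + τ) + (∑ {K} (λ _ → 1ℚ) + ∑ {K} λ _ → ∑ {ℓ} λ _ → 1ℚ)))) ≡
              2ℚ + (trunkWeight * β + itemWeight * ι K)
      groupValue = begin
        1ℚ + (β + (∑ {W} (λ _ → β) + (∑ {W} (λ _ → β + τ) + (∑ {K} (λ _ → 1ℚ) + ∑ {K} λ _ → ∑ {ℓ} λ _ → 1ℚ))))
          ≡⟨ cong (1ℚ +_) (cong (β +_) (cong₂ _+_ (∑-const W β) (cong₂ _+_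
               (trans (∑-+ {W} (λ _ → β) (λ _ → τ)) (cong₂ _+_ (∑-const W β) ∑τ≡1))
               (cong₂ _+_ (∑-const K 1ℚ) (trans (∑-cong {K} λ _ → ∑-const ℓ 1ℚ) (∑-const K (ι ℓ * 1ℚ))))))) ⟩
        1ℚ + (β + (ι W * β + ((ι W * β + 1ℚ) + (ι K * 1ℚ + ι K * (ι ℓ * 1ℚ)))))
          ≡⟨ solve 4 (λ b w z l → con 1ℚ :+ (b :+ (w :* b :+ ((w :* b :+ con 1ℚ) :+ (z :* con 1ℚ :+ z :* (l :* con 1ℚ))))) :=
               con 2ℚ :+ ((con 1ℚ :+ con 2ℚ :* w) :* b :+ (con 1ℚ :+ l) :* z)) refl β (ι W) (ι K) (ι ℓ) ⟩
        2ℚ + (trunkWeight * β + itemWeight * ι K) ∎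

    lp-optimum : IsOptimum (LPFeasible graph (from root)) lpValue
    lp-optimum = (assignment , solution-feasible , solution-value) , lp≤

-- Existence of an integral optimum

vectors : ∀ {A : Set} → List A → ∀ n → List (Vec A n)
vectors xs zero    = [] ∷ []
vectors xs (suc n) = cartesianProductWith _∷_ xs (vectors xs n)

∈-vectors : ∀ {A : Set} {xs : List A} → (∀ x → x ∈ᴸ xs) → ∀ {n} (v : Vec A n) → v ∈ᴸ vectors xs n
∈-vectors all []      = here refl
∈-vectors all (x ∷ v) = ∈-cartesianProductWith⁺ _∷_ (all x) (∈-vectors all v)

∈-booleans : ∀ b → b ∈ᴸ true ∷ false ∷ []
∈-booleans true  = here refl
∈-booleans false = there (here refl)

bit : Bool → ℚ
bit b = only-if b 1ℚ

bit-unit : ∀ b → 0ℚ ≤ bit b × bit b ≤ 1ℚ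
bit-unit true  = 0≤1 , ≤-refl
bit-unit false = ≤-refl , 0≤1

bit-integer : ∀ b → IsInteger (bit b)
bit-integer true  = ℤ.+ 1 , refl
bit-integer false = ℤ.+ 0 , refl

bit-of : ∀ {q} → q ≡ 0ℚ ⊎ q ≡ 1ℚ → bit (does (q ℚ.≟ 1ℚ)) ≡ q
bit-of (inj₁ refl) = refl
bit-of (inj₂ refl) = refl

module _ {n} (G : Digraph n) (r : Fin n) where
  open Digraph G

  -- The constraints read `X` on arcs only, so its other entries may change, as they do when an
  -- integral point is encoded and decoded.
  lp-cong : ∀ {a a′ : Assignment n} → let open Assignment in
            (∀ u → Y a u ≡ Y a′ u) → (∀ {t h} → Arc t h → X a t h ≡ X a′ t h) →
            LPFeasible G r a → LPFeasible G r a′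
  lp-cong {a} {a′} Y≡ X≡ lp = record
    { in-degree    = λ u → subst₂ (λ s y → s ≤ 2ℚ * y)
        (trans (F.inflow u) (trans (∑-cong λ t → flow≡ t u) (sym (F′.inflow u)))) (Y≡ u) (in-degree u)
    ; out-degree   = λ u u≢r → trans (trans (F′.outflow u) (trans (∑-cong λ h → sym (flow≡ u h))
        (sym (F.outflow u)))) (trans (out-degree u u≢r) (Y≡ u))
    ; connectivity = λ S r∉S u u∈S → subst₂ _≤_ (Y≡ u)
        (trans (F.cutflow S) (trans (∑-cong λ t → ∑-cong λ h → cong (only-if (crosses S t h)) (flow≡ t h))
          (sym (F′.cutflow S)))) (connectivity S r∉S u u∈S)
    ; Y-bounds     = λ u → subst (λ y → 0ℚ ≤ y × y ≤ 1ℚ) (Y≡ u) (Y-bounds u)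
    ; X-bounds     = λ arc → subst (λ x → 0ℚ ≤ x × x ≤ 1ℚ) (X≡ arc) (X-bounds arc)
    }
    where
    open LPFeasible lp
    module F = Flow G (Assignment.X a)
    module F′ = Flow G (Assignment.X a′)
    flow≡ : ∀ t h → F.flow t h ≡ F′.flow t h
    flow≡ t h with arc? t h
    ... | yes arc = X≡ arc
    ... | no _    = refl

  -- Integral feasible values are 0 or 1, so up to entries off the arcs there are finitely many
  -- candidates, and a maximum can be found by enumeration.
  Code : Set
  Code = Vec Bool n × Vec (Vec Bool n) n

  codes : List Code
  codes = cartesianProduct (vectors (true ∷ false ∷ []) n) (vectors (vectors (true ∷ false ∷ []) n) n)

  ∈-codes : ∀ c → c ∈ᴸ codes
  ∈-codes (y , x) = ∈-cartesianProduct⁺ (∈-vectors ∈-booleans y) (∈-vectors (∈-vectors ∈-booleans) x)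

  decode : Code → Assignment n
  decode (y , x) = record { Y = λ u → bit (y ‼ u) ; X = λ t h → bit ((x ‼ t) ‼ h) }

  encode : Assignment n → Code
  encode a = tabulate (λ u → does (Y u ℚ.≟ 1ℚ)) , tabulate λ t → tabulate λ h → does (X t h ℚ.≟ 1ℚ)
    where open Assignment a

  -- The cut constraints are decided by searching for a violated one; if there is none, decidability
  -- of `≤` gives them back. The bounds hold for every code by `bit-unit`.
  feasible? : ∀ c → Dec (LPFeasible G r (decode c))
  feasible? c = map′ build split
    (Fin.all? (λ u → _ ℚ.≤? _) ×-dec Fin.all? (λ u → ¬? (u Fin.≟ r) →-dec (_ ℚ.≟ _)) ×-dec
     ¬? (anySubset? λ S → ¬? (r ∈? S) ×-dec Fin.any? λ u → (u ∈? S) ×-dec ¬? (Y u ℚ.≤? ∑ᴬ (δoutˢ G S) X)))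
    where
    open Assignment (decode c)
    Constraints = (∀ u → ∑ᴬ (δin G u) X ≤ 2ℚ * Y u) × (∀ u → u ≢ r → ∑ᴬ (δout G u) X ≡ Y u) ×
                  ¬ (∃[ S ] (r ∉ S × (∃[ u ] (u ∈ S × ¬ (Y u ≤ ∑ᴬ (δoutˢ G S) X)))))
    build : Constraints → LPFeasible G r (decode c)
    build (ins , outs , cuts) = record
      { in-degree    = ins
      ; out-degree   = outs
      ; connectivity = λ S r∉S u u∈S → decidable-stable (Y u ℚ.≤? ∑ᴬ (δoutˢ G S) X)
          λ ¬le → cuts (S , r∉S , u , u∈S , ¬le)
      ; Y-bounds     = λ u → bit-unit (proj₁ c ‼ u)
      ; X-bounds     = λ {t} {h} _ → bit-unit ((proj₂ c ‼ t) ‼ h)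
      }
    split : LPFeasible G r (decode c) → Constraints
    split lp = in-degree , out-degree , λ (S , r∉S , u , u∈S , ¬le) → ¬le (connectivity S r∉S u u∈S)
      where open LPFeasible lp

  decode-integral : ∀ {c} → LPFeasible G r (decode c) → IPFeasible G r (decode c)
  decode-integral {c} lp = record
    { lpFeasible = lp
    ; Y-integral = λ u → bit-integer (proj₁ c ‼ u)
    ; X-integral = λ {t} {h} _ → bit-integer ((proj₂ c ‼ t) ‼ h)
    }

  module _ {a : Assignment n} (ip : IPFeasible G r a) where
    open IPFeasible ip
    open LPFeasible lpFeasible
    open Assignment a

    decode-encode-Y : ∀ u → Y u ≡ Assignment.Y (decode (encode a)) u
    decode-encode-Y u = sym (trans (cong bit (lookup∘tabulate _ u))
      (bit-of (integer-unit (Y-integral u) (proj₁ (Y-bounds u)) (proj₂ (Y-bounds u)))))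

    decode-encode-X : ∀ {t h} → Arc t h → X t h ≡ Assignment.X (decode (encode a)) t h
    decode-encode-X {t} {h} arc = sym (trans
      (cong bit (trans (cong (_‼ h) (lookup∘tabulate _ t)) (lookup∘tabulate _ h)))
      (bit-of (integer-unit (X-integral arc) (proj₁ (X-bounds arc)) (proj₂ (X-bounds arc)))))

    encode-feasible : LPFeasible G r (decode (encode a))
    encode-feasible = lp-cong decode-encode-Y decode-encode-X lpFeasible

    encode-objective : objective a ≡ objective (decode (encode a))
    encode-objective = ∑-cong decode-encode-Y

  -- An integral point of value one: it starts the search for the maximum and makes the optimum
  -- positive.
  rootOnly : Assignment n
  rootOnly = record { Y = λ u → bit (does (u Fin.≟ r)) ; X = λ _ _ → 0ℚ }

  rootOnly-feasible : IPFeasible G r rootOnly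
  rootOnly-feasible = record
    { lpFeasible = record
      { in-degree    = λ u → ≤-trans (≤-reflexive (no-flow (δin G u)))
          (*-nonneg {2ℚ} (nonNegative⁻¹ 2ℚ) (proj₁ (bit-unit (does (u Fin.≟ r)))))
      ; out-degree   = λ u u≢r → trans (no-flow (δout G u)) (sym (cong bit (dec-false (u Fin.≟ r) u≢r)))
      ; connectivity = λ S r∉S u u∈S → ≤-reflexive (trans
          (cong bit (dec-false (u Fin.≟ r) λ { refl → r∉S u∈S })) (sym (no-flow (δoutˢ G S))))
      ; Y-bounds     = λ u → bit-unit (does (u Fin.≟ r))
      ; X-bounds     = λ _ → ≤-refl , 0≤1
      }
    ; Y-integral = λ u → bit-integer (does (u Fin.≟ r))
    ; X-integral = λ _ → ℤ.+ 0 , refl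
    }
    where
    no-flow : ∀ F → ∑ᴬ F (λ _ _ → 0ℚ) ≡ 0ℚ
    no-flow F = trans (∑-cong λ t → trans (∑-cong λ h → zero-either-way (F t h)) (∑-zero n)) (∑-zero n)
      where
      zero-either-way : ∀ b → only-if b 0ℚ ≡ 0ℚ
      zero-either-way true  = refl
      zero-either-way false = refl

  ip-optimum : ∃[ v ] IsOptimum (IPFeasible G r) v × 0ℚ < v
  ip-optimum = value best , ((decode best , best-feasible , refl) , best-bound) ,
    <-≤-trans (positive⁻¹ 1ℚ) (≤-trans (≤-reflexive (sym (∑-only r λ _ → 1ℚ))) (best-bound rootOnly rootOnly-feasible))
    where
    open Data.List.Extrema (DecTotalOrder.totalOrder ≤-decTotalOrder) using (argmax; argmax-all; f[xs]≤f[argmax])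
    value : Code → ℚ
    value = objective ∘ decode
    best : Code
    -- The default is itself feasible, so the result is feasible whether `argmax` returns it or a
    -- member of the list.
    best = argmax value (encode rootOnly) (filter feasible? codes)
    best-feasible : IPFeasible G r (decode best)
    best-feasible = decode-integral {best} (argmax-all value {LPFeasible G r ∘ decode}
      (encode-feasible rootOnly-feasible) (all-filter feasible? codes))
    best-bound : ∀ a → IPFeasible G r a → objective a ≤ value best
    best-bound a ip = ≤-trans (≤-reflexive (encode-objective ip))
      (lookup (f[xs]≤f[argmax] {f = value} (encode rootOnly) (filter feasible? codes))
        (∈-filter⁺ feasible? (∈-codes (encode a)) (encode-feasible ip)))

-- The family

1/-right : ∀ {p} → 0ℚ < p → Σ[ q ∈ ℚ ] p * q ≡ 1ℚ × 0ℚ ≤ q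
1/-right {p} 0<p = 1/p , *-inverseʳ p , nonNegative⁻¹ 1/p {{pos⇒nonNeg 1/p {{1/pos⇒pos p}}}}
  where
  instance
    p-positive : Positive p
    p-positive = positive 0<p
    p-nonZero : NonZero p
    p-nonZero = pos⇒nonZero p
  1/p = 1/ p

cube-mono-≤ : ∀ {p q} → 0ℚ ≤ p → p ≤ q → p * p * p ≤ q * q * q
cube-mono-≤ {p} {q} 0≤p p≤q = ≤-trans
  (*-monoʳ p 0≤p (≤-trans (*-monoʳ p 0≤p p≤q) (*-monoˡ q 0≤q p≤q)))
  (*-monoˡ (q * q) (*-nonneg 0≤q 0≤q) p≤q)
  where 0≤q = ≤-trans 0≤p p≤q

optimum-≤ : ∀ {n} {Feasible : Assignment n → Set} {v b} → IsOptimum Feasible v →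
            (∀ a → Feasible a → objective a ≤ b) → v ≤ b
optimum-≤ {b = b} ((a , feasible , value≡v) , _) bound = subst (_≤ b) value≡v (bound a feasible)

module Instance (N : ℕ) where

  -- The shift by two gives `2β ≤ 1` for `β = 1/m`, from which `β + τ ≤ 1` follows.
  m : ℕ
  m = 2 ℕ.+ N

  M : ℚ
  M = ι m

  open Gadget (m ℕ.+ m) (m ℕ.* m) m m using (V-finite; Group-finite; root; graph; acyclic) public
  open GadgetValue (m ℕ.+ m) (m ℕ.* m) m m using (lpValue; ipBound; ip≤; lp-optimum)
  open Finite V-finite using (size; from) public

  2≤M : 2ℚ ≤ M
  2≤M = ι-mono-≤ (ℕ.m≤m+n 2 N)

  0≤M : 0ℚ ≤ M
  0≤M = ι-nonneg m

  private
    inverse = 1/-right (<-≤-trans (positive⁻¹ 2ℚ) 2≤M)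

  β : ℚ
  β = proj₁ inverse

  M*β≡1 : M * β ≡ 1ℚ
  M*β≡1 = proj₁ (proj₂ inverse)

  0≤β : 0ℚ ≤ β
  0≤β = proj₂ (proj₂ inverse)

  τ : ℚ
  τ = β * β

  0≤τ : 0ℚ ≤ τ
  0≤τ = *-nonneg 0≤β 0≤β

  2β≤1 : 2ℚ * β ≤ 1ℚ
  2β≤1 = ≤-trans (*-monoʳ β 0≤β 2≤M) (≤-reflexive M*β≡1)

  β+β≤1 : β + β ≤ 1ℚ
  β+β≤1 = subst (_≤ 1ℚ) (2*p≡p+p β) 2β≤1

  β+τ≤1 : β + τ ≤ 1ℚ
  -- `τ = β * β` is at most `β`, because `β ≤ β + β ≤ 1`.
  β+τ≤1 = ≤-trans (+-monoʳ-≤ β (≤-trans (*-monoˡ β 0≤β (≤-trans (p≤p+q 0≤β) β+β≤1))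
    (≤-reflexive (*-identityʳ β)))) β+β≤1

  ∑β≡2 : ∑ {m ℕ.+ m} (λ _ → β) ≡ 2ℚ
  ∑β≡2 = trans (∑-const (m ℕ.+ m) β) (trans (cong (_* β) (ι-+ m m))
    (trans (*-distribʳ-+ β M M) (cong₂ _+_ M*β≡1 M*β≡1)))

  ∑τ≡1 : ∑ {m ℕ.* m} (λ _ → τ) ≡ 1ℚ
  ∑τ≡1 = trans (∑-const (m ℕ.* m) τ) (trans (cong (_* τ) (ι-* m m))
    (trans (solve 2 (λ x b → (x :* x) :* (b :* b) := (x :* b) :* (x :* b)) refl M β)
      (cong₂ _*_ M*β≡1 M*β≡1)))
    where open +-*-Solver

  ∑τ≤ : ∑ {m} (λ _ → τ) ≤ 2ℚ * (β + τ)
  ∑τ≤ = begin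
    ∑ {m} (λ _ → τ)     ≡⟨ ∑-const m τ ⟩
    M * (β * β)         ≡⟨ *-assoc M β β ⟨
    M * β * β           ≡⟨ cong (_* β) M*β≡1 ⟩
    1ℚ * β              ≡⟨ *-identityˡ β ⟩
    β                   ≤⟨ p≤p+q 0≤τ ⟩
    β + τ               ≤⟨ p≤p+q (+-nonneg 0≤β 0≤τ) ⟩
    (β + τ) + (β + τ)   ≡⟨ 2*p≡p+p (β + τ) ⟨
    2ℚ * (β + τ)        ∎
    where open ≤-Reasoning

  -- `ipBound` is 14M² + 14M + 5 and `lpValue` is 2M³ + 6M² + 4M + 5. Seven is the ratio of the
  -- leading coefficients, and the polynomial added in the first step is the exact difference.
  M*ipBound≤7*lpValue : M * ipBound ≤ ι 7 * lpValue
  M*ipBound≤7*lpValue = begin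
    M * ipBound              ≤⟨ p≤p+q (+-nonneg (+-nonneg (*-nonneg (ι-nonneg 28) (*-nonneg 0≤M 0≤M))
                                  (*-nonneg (ι-nonneg 23) 0≤M)) (ι-nonneg 35)) ⟩
    M * ipBound + (ι 28 * (M * M) + ι 23 * M + ι 35)
      ≡⟨ cong₂ (λ k w → M * bound k w (k * ι 4 + M * 2ℚ) + (ι 28 * (M * M) + ι 23 * M + ι 35)) (ι-+ m m) (ι-* m m) ⟩
    M * bound (M + M) (M * M) ((M + M) * ι 4 + M * 2ℚ) + (ι 28 * (M * M) + ι 23 * M + ι 35)
      ≡⟨ solve 1 (λ x →
           x :* (boundᵖ (x :+ x) (x :* x) ((x :+ x) :* con (ι 4) :+ x :* con 2ℚ) x) :+
             (con (ι 28) :* (x :* x) :+ con (ι 23) :* x :+ con (ι 35)) :=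
           con (ι 7) :* boundᵖ (x :+ x) (x :* x) ((x :+ x) :* x) x) refl M ⟩
    ι 7 * bound (M + M) (M * M) ((M + M) * M)
      ≡⟨ cong₂ (λ k w → ι 7 * bound k w (k * M)) (ι-+ m m) (ι-* m m) ⟨
    ι 7 * lpValue            ∎
    where
    open ≤-Reasoning
    open +-*-Solver
    bound : ℚ → ℚ → ℚ → ℚ
    bound k w z = (ι 3 + (k * 2ℚ + (1ℚ + 2ℚ * w) * 2ℚ)) + (1ℚ + M) * z
    boundᵖ : ∀ {n} (k w z x : Polynomial n) → Polynomial n
    boundᵖ k w z x = (con (ι 3) :+ (k :* con 2ℚ :+ (con 1ℚ :+ con 2ℚ :* w) :* con 2ℚ)) :+ (con 1ℚ :+ x) :* z

  -- The size is 6m³ + 2m² + 4m + 3. The factor 27 leaves room for the lower terms and is a cube.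
  size≤27m³ : size ℕ.≤ 27 ℕ.* (m ℕ.* m ℕ.* m)
  size≤27m³ = subst (size ℕ.≤_)
    -- Expanded in `N` with `m = 2 + N`, the difference has natural coefficients, so it can be added
    -- instead of subtracted.
    (solve 1 (λ x → let y = con 2 :+ x in
        con 3 :+ (y :+ y) :* (con 1 :+ (con 1 :+ (y :* y :+ (y :* y :+ (y :+ y :* y))))) :+
        (con 149 :+ con 240 :* x :+ con 124 :* (x :* x) :+ con 21 :* (x :* x :* x)) :=
        con 27 :* (y :* y :* y)) refl N)
    (ℕ.m≤m+n size _)
    where open ℕSolver.+-*-Solver

  N≤size : size ≥ N
  N≤size = ℕ.≤-trans (ℕ.≤-trans (ℕ.m≤n+m N 2) (ℕ.m≤m+n m m))
    (ℕ.≤-trans (ℕ.m≤m*n (m ℕ.+ m) (Finite.size Group-finite)) (ℕ.m≤n+m ((m ℕ.+ m) ℕ.* Finite.size Group-finite) 3))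

  optimum : ∃[ v ] IsOptimum (IPFeasible graph (from root)) v × 0ℚ < v
  optimum = ip-optimum graph (from root)

  ip : ℚ
  ip = proj₁ optimum

  0<ip : 0ℚ < ip
  0<ip = proj₂ (proj₂ optimum)

  ip-optimal : IsOptimum (IPFeasible graph (from root)) ip
  ip-optimal = proj₁ (proj₂ optimum)

  ip≤ipBound : ip ≤ ipBound
  ip≤ipBound = optimum-≤ ip-optimal ip≤

  -- The exact integral optimum stays implicit: the ratio is formed with its inverse, and its
  -- estimate uses only `ip ≤ ipBound`.
  ρ : ℚ
  ρ = lpValue * proj₁ (1/-right 0<ip)

  ρ*ip≡lpValue : ρ * ip ≡ lpValue
  ρ*ip≡lpValue = begin
    lpValue * q * ip     ≡⟨ *-assoc lpValue q ip ⟩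
    lpValue * (q * ip)   ≡⟨ cong (lpValue *_) (trans (*-comm q ip) (proj₁ (proj₂ (1/-right 0<ip)))) ⟩
    lpValue * 1ℚ         ≡⟨ *-identityʳ lpValue ⟩
    lpValue              ∎
    where
    open ≡-Reasoning
    q = proj₁ (1/-right 0<ip)

  gap : IsGap graph (from root) ρ
  gap = lpValue , ip , lp-optimum-m , ip-optimal , 0<ip , ρ*ip≡lpValue
    where
    lp-optimum-m = lp-optimum β τ 0≤β 0≤τ β+τ≤1 ∑β≡2 ∑τ≡1 ∑τ≤

  1/7 : ℚ
  1/7 = ℤ.+ 1 / 7

  M/7≤ρ : 1/7 * M ≤ ρ
  M/7≤ρ = *-cancelʳ-≤-pos ip {{positive 0<ip}} (begin
    1/7 * M * ip               ≡⟨ *-assoc 1/7 M ip ⟩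
    1/7 * (M * ip)             ≤⟨ *-monoˡ 1/7 0≤1/7 (*-monoˡ M 0≤M ip≤ipBound) ⟩
    1/7 * (M * ipBound)        ≤⟨ *-monoˡ 1/7 0≤1/7 M*ipBound≤7*lpValue ⟩
    1/7 * (ι 7 * lpValue)      ≡⟨ *-assoc 1/7 (ι 7) lpValue ⟨
    1/7 * ι 7 * lpValue        ≡⟨ *-identityˡ lpValue ⟩
    lpValue                    ≡⟨ ρ*ip≡lpValue ⟨
    ρ * ip                     ∎)
    where
    open ≤-Reasoning
    0≤1/7 : 0ℚ ≤ 1/7
    0≤1/7 = nonNegative⁻¹ 1/7

  1/21 : ℚ
  1/21 = ℤ.+ 1 / 21

  -- 21 = 7 · 3: seven from `M/7≤ρ`, three as the cube root of the 27 in `size≤27m³`.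
  large : 1/21 ·∛ size ≤ ρ
  large = begin
    1/21 * 1/21 * 1/21 * ι size                       ≤⟨ *-monoˡ (1/21 * 1/21 * 1/21) (nonNegative⁻¹ (1/21 * 1/21 * 1/21))
                                                           (ι-mono-≤ size≤27m³) ⟩
    1/21 * 1/21 * 1/21 * ι (27 ℕ.* (m ℕ.* m ℕ.* m))   ≡⟨ cong (1/21 * 1/21 * 1/21 *_) (trans (ι-* 27 (m ℕ.* m ℕ.* m))
                                                           (cong (ι 27 *_) (trans (ι-* (m ℕ.* m) m) (cong (_* M) (ι-* m m))))) ⟩
    1/21 * 1/21 * 1/21 * (ι 27 * (M * M * M))         ≡⟨ solve 1 (λ x → con (1/21 * 1/21 * 1/21) :* (con (ι 27) :* (x :* x :* x)) :=
                                                           (con 1/7 :* x) :* (con 1/7 :* x) :* (con 1/7 :* x)) refl M ⟩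
    (1/7 * M) * (1/7 * M) * (1/7 * M)                 ≤⟨ cube-mono-≤ (*-nonneg {1/7} (nonNegative⁻¹ 1/7) 0≤M) M/7≤ρ ⟩
    ρ * ρ * ρ                                         ∎
    where
    open ≤-Reasoning
    open +-*-Solver

theorem3p8 : Σ[ c ∈ ℚ ] (0ℚ < c ×
    (∀ (N : ℕ) →
    Σ[ n ∈ ℕ ] (n ≥ N ×
    (Σ[ G ∈ Digraph n ] Σ[ r ∈ Fin n ]
    (Acyclic G ×
    (Σ[ ρ ∈ ℚ ] (IsGap G r ρ × c ·∛ n ≤ ρ)))))))
theorem3p8 = ℤ.+ 1 / 21 , positive⁻¹ (ℤ.+ 1 / 21) , λ N → let open Instance N in
  size , N≤size , graph , from root , acyclic , ρ , gap , large
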